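{- Let $m\ge 2$ be an integer. Then \[ \sum_{\mu\in\mathcal{P}}t^{h_{m-1,1}(\mu)}q^{|\mu|} =\sum_{\{s_i\} \in \mathcal{S}_m} q^{(m-1)\binom{s_1}{2} + \sum_i s_i} \prod_{j\geq 1} \left[{s_j - s_{j+m} + \chi (m-1 \mid j) \atop s_{j+1} - s_{j+m}}\right]_t . \]
   Context: $\mathcal{P}$ is the set of all partitions, viewed as Young diagrams; $|\mu|$ is the number of cells. For a cell $v$, $a_v$ (arm length) is the number of cells to its right in its row and $l_v$ (leg length) the number of cells below it in its column. For non-negative integers $\alpha,\beta$, not both zero, $h_{\alpha,\beta}(\mu)$ is the number of cells $v$ of $\mu$ with $\alpha l_v=\beta(a_v+1)$ and $(\alpha+\beta)\mid a_v+l_v+1$. $\chi(P)$ is $1$ if statement $P$ holds and $0$ otherwise. $\mathcal{S}_m$ is the set of sequences $\{s_i\}_{i>0}$ of non-negative integers, only finitely many nonzero, such that $s_i \geq s_{i+1} - \chi (m-1 \mid i)$ and $s_i \geq s_{i+(m-1)}$ for all $i\ge 1$. $\left[{a\atop b}\right]_t$ denotes the Gaussian ($t$-)binomial coefficient, taken to be $0$ if an entry is negative or $b>a$. -}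

module Defs where

open import Data.Nat using (ℕ; zero; suc; _+_; _*_; _∸_; _≤ᵇ_; _≡ᵇ_)
open import Data.Nat.Combinatorics using (_C_)
open import Data.Nat.Divisibility using (_∣?_)
open import Data.Integer as ℤ using (ℤ; +_; -[1+_])
open import Data.Bool using (Bool; true; false; _∧_; if_then_else_)
open import Data.List using (List; []; _∷_; map; concatMap; upTo; length; filter; foldr)
open import Data.Nat.ListAction using (sum)
open import Relation.Nullary.Decidable using (⌊_⌋)
open import Data.Product using (_×_; _,_)
open import Relation.Nullary using (Dec; yes; no)

-- Polynomials in t with natural coefficients, as coefficient lists
-- (head = coefficient of t^0).

Poly : Set
Poly = List ℕ

infixl 6 _⊕_
infixl 7 _⊗_

_⊕_ : Poly → Poly → Poly
[] ⊕ q = q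
(a ∷ p) ⊕ [] = a ∷ p
(a ∷ p) ⊕ (b ∷ q) = (a + b) ∷ (p ⊕ q)

_⊗_ : Poly → Poly → Poly
[] ⊗ q = []
(a ∷ p) ⊗ q = map (a *_) q ⊕ (0 ∷ (p ⊗ q))

one : Poly
one = 1 ∷ []

tpow* : ℕ → Poly → Poly
tpow* zero p = p
tpow* (suc k) p = 0 ∷ tpow* k p

coeff : ℕ → Poly → ℕ
coeff k [] = 0
coeff zero (a ∷ p) = a
coeff (suc k) (a ∷ p) = coeff k p

-- Gaussian binomial [a over b]_t for natural a, b (zero if b > a),
-- via the t-Pascal rule [a+1, b+1] = [a, b] + t^(b+1) [a, b+1].
gaussℕ : ℕ → ℕ → Poly
gaussℕ zero zero = one
gaussℕ zero (suc b) = []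
gaussℕ (suc a) zero = one
gaussℕ (suc a) (suc b) = gaussℕ a b ⊕ tpow* (suc b) (gaussℕ a (suc b))

gauss : ℤ → ℤ → Poly
gauss (+ a) (+ b) = gaussℕ a b
gauss (+ a) -[1+ b ] = []
gauss -[1+ a ] b = []

χ∣ : ℕ → ℕ → ℕ
χ∣ d j with d ∣? j
... | yes _ = 1
... | no _ = 0

range1 : ℕ → List ℕ
range1 n = map suc (upTo n)

lists : ℕ → ℕ → List (List ℕ)
lists zero b = [] ∷ []
lists (suc N) b = concatMap (λ x → map (x ∷_) (lists N b)) (upTo (suc b))

count : {A : Set} → (A → Bool) → List A → ℕ
count p xs = length (filter (λ x → Data.Bool._≟_ (p x) true) xs)
  where import Data.Bool

-- 1-indexed access, 0 outside the list:  at s i = s_i  for i ≥ 1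
at : List ℕ → ℕ → ℕ
at [] i = 0
at (x ∷ s) zero = 0
at (x ∷ s) (suc zero) = x
at (x ∷ s) (suc (suc i)) = at s (suc i)

-- Partitions.  A partition μ of n is represented by the list
-- (μ₁, ..., μₙ) of length n (padded with zeros), weakly decreasing,
-- with sum n.  This is a bijection with partitions of n.

nonincr : List ℕ → Bool
nonincr [] = true
nonincr (x ∷ []) = true
nonincr (x ∷ y ∷ s) = (y ≤ᵇ x) ∧ nonincr (y ∷ s)

isPartitionOf : ℕ → List ℕ → Bool
isPartitionOf n μ = nonincr μ ∧ (sum μ ≡ᵇ n)

partitionsOf : ℕ → List (List ℕ)
partitionsOf n = filter (λ μ → Data.Bool._≟_ (isPartitionOf n μ) true) (lists n n)
  where import Data.Bool

conj : List ℕ → ℕ → ℕ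
conj μ c = count (λ x → c ≤ᵇ x) μ

-- cell (r, c) in row r, column c (1-indexed), with c ≤ μ_r
arm : List ℕ → ℕ → ℕ → ℕ
arm μ r c = at μ r ∸ c

leg : List ℕ → ℕ → ℕ → ℕ
leg μ r c = conj μ c ∸ r

cells : List ℕ → List (ℕ × ℕ)
cells μ = concatMap (λ r → map (λ c → (r , c)) (range1 (at μ r))) (range1 (length μ))

hcond : ℕ → ℕ → ℕ → ℕ → Bool
hcond α β a l = (α * l ≡ᵇ β * (a + 1)) ∧ ⌊ (α + β) ∣? (a + l + 1) ⌋

h : ℕ → ℕ → List ℕ → ℕ
h α β μ = count (λ { (r , c) → hcond α β (arm μ r c) (leg μ r c) }) (cells μ)

lhsCoeff : ℕ → ℕ → ℕ → ℕ
lhsCoeff m n k = count (λ μ → h (m ∸ 1) 1 μ ≡ᵇ k) (partitionsOf n)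

-- Sequences in S_m.  A sequence with support in {1, ..., N} is
-- represented by the list (s₁, ..., s_N); s_i = 0 for i > N.
-- The defining conditions (for all i ≥ 1)
--    s_i ≥ s_{i+1} - χ(m-1 ∣ i)   and   s_i ≥ s_{i+(m-1)}
-- hold trivially for i > N (all entries involved are 0), so it
-- suffices to check i ∈ {1, ..., N}.

condS : ℕ → List ℕ → ℕ → Bool
condS m s i = (at s (suc i) ≤ᵇ at s i + χ∣ (m ∸ 1) i) ∧ (at s (i + (m ∸ 1)) ≤ᵇ at s i)

inS : ℕ → List ℕ → Bool
inS m s = foldr (λ i b → condS m s i ∧ b) true (range1 (length s))

qexp : ℕ → List ℕ → ℕ
qexp m s = (m ∸ 1) * (at s 1 C 2) + sum s

factor : ℕ → List ℕ → ℕ → Poly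
factor m s j = gauss (+ at s j ℤ.- + at s (j + m) ℤ.+ + χ∣ (m ∸ 1) j)
                     (+ at s (suc j) ℤ.- + at s (j + m))

-- Π_{j ≥ 1} of the factors; for j > N every factor is [χ over 0]_t = 1,
-- so the product over j ∈ {1, ..., N} is the full product.
prodFactors : ℕ → List ℕ → Poly
prodFactors m s = foldr (λ j p → factor m s j ⊗ p) one (range1 (length s))

-- coefficient of t^k q^n in the right-hand side, truncated to sequences
-- supported in {1, ..., N}.  (Entries of a sequence contributing to q^n
-- are ≤ n, since q's exponent is ≥ Σ s_i.)
rhsCoeffTrunc : ℕ → ℕ → ℕ → ℕ → ℕ
rhsCoeffTrunc m N n k =
  sum (map (λ s → if inS m s ∧ (qexp m s ≡ᵇ n) then coeff k (prodFactors m s) else 0)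
           (lists N n))

{-# OPTIONS --safe #-}
-- Put d = m − 1 and give the lattice point in row i and column c the level d i + c.  Read from
-- the bottom left corner, the boundary of a partition is a path of N-steps, which lower the
-- level by d, and E-steps, which raise it by 1.  A cell with d l = a + 1 is a pair of an E-step
-- and a later N-step that leave the same level.  The multiset of the levels of the N-steps
-- determines the number of E-steps leaving each level, by the flow through the cut above it.
-- As in the BEST theorem, the paths with a given multiset correspond to the choices, at each
-- level, of the word of steps leaving it; the last letter must be E, because the path has to
-- return upwards one level at a time.  Hence the sum of t^h over these paths is a product of
-- Gaussian binomials: both sides satisfy the recursion given by the first step, which changes
-- only the factor of the current level (this is a t-Pascal rule).  Finally, the multisets that
-- occur are in bijection with S_m: s_j is the number of cells on the j-th diagonal after the
-- full ones, whose cells account for (m − 1) binom(s_1, 2).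
module Submission where

open import Defs
open import Data.Nat using (ℕ; zero; suc; _+_; _*_; _∸_; _≤_; _<_; _≤ᵇ_; _≡ᵇ_; z≤n; s≤s; s≤s⁻¹; z<s; s<s; _≤?_; >-nonZero)
open import Data.Product using (∃-syntax)
open import Relation.Binary.PropositionalEquality hiding ([_]; J)
open import Data.Nat.Properties
open import Algebra.Properties.CommutativeSemigroup +-commutativeSemigroup using () renaming (interchange to +-interchange)
open import Data.Nat.Combinatorics using (_C_; nC1≡n; nCk+nC[k+1]≡[n+1]C[k+1])
open import Data.Nat.Divisibility using (_∣_; _∣?_; divides; ∣m+n∣m⇒∣n; m∣m*n)
open import Data.Nat.ListAction using (sum)
open import Data.Nat.ListAction.Properties using (sum-++; sum-↭)
open import Data.Nat.Tactic.RingSolver using (solve-∀)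
open import Data.Integer using () renaming (+_ to pos; _+_ to _+ℤ_; _-_ to _-ℤ_; -_ to -ℤ_)
import Data.Integer.Properties as ℤₚ
open import Data.Bool using (Bool; true; false; _∧_; if_then_else_; T)
open import Data.Bool.Properties using (∧-assoc; ∧-comm; T-≡)
open import Data.List using (List; []; _∷_; _++_; [_]; map; concatMap; upTo; applyUpTo; length; filter; foldr; reverse)
open import Data.List.Properties using (unfold-reverse; length-reverse; length-applyUpTo; map-++; map-∘; map-cong)
open import Data.List.Relation.Binary.Permutation.Propositional.Properties using (↭-reverse)
open import Data.Product using (_×_; _,_; proj₁; proj₂)
open import Data.Sum using (_⊎_; inj₁; inj₂)
open import Data.Empty using (⊥-elim)
open import Data.Unit using (⊤; tt)
open import Function using (_∘_; id)
open import Function.Bundles using (Equivalence)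
open import Relation.Nullary using (¬_; yes; no)
open import Relation.Nullary.Decidable using (⌊_⌋; dec-true; isYes≗does)
open import Relation.Binary using (tri<; tri≈; tri>)
open import Relation.Binary.Bundles using (Setoid)
import Relation.Binary.Reasoning.Setoid as SetoidReasoning

-- All partitions of `n` are padded to `n` rows, so every path starts at level `d n`; the padding
-- consists of N-steps before the first E-step, which form no pairs. After its last N-step a path
-- goes on with E-steps forever. Hence the net upward flow is 1 through each cut above the start and
-- 0 below it, which is the summand `le v L` of `esteps`. The empty partition has N-steps at d, 2d,
-- ..., nd and one E-step at each level. Comparison with it gives the dictionary: at a level d s_1 +
-- j up to d n, with j positive, there are s_j + χ(d | j) - s_{j+1} N-steps and 1 + s_{j+1} -
-- s_{j+m} E-steps. So the two conditions of S_m say that no number of N-steps is negative and that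
-- some E-step leaves each level from d s_1 on; the lower entry of a Gaussian binomial counts the
-- E-steps other than the final one. The correspondence with S_m enters as double counting: each
-- product is expanded into a sum over paths, the two sums are exchanged, and for each path the
-- matching sequences are counted.

-- Indicators and finite sums.

ι : Bool → ℕ
ι true = 1
ι false = 0

le eq : ℕ → ℕ → ℕ
le x y = ι (x ≤ᵇ y)
eq x y = ι (x ≡ᵇ y)

T⇒ι≡1 : ∀ {b} → T b → ι b ≡ 1
T⇒ι≡1 {true} _ = refl

¬T⇒ι≡0 : ∀ {b} → ¬ T b → ι b ≡ 0
¬T⇒ι≡0 {false} _ = refl
¬T⇒ι≡0 {true} ¬t = ⊥-elim (¬t tt)

ι-∧ : ∀ a b → ι (a ∧ b) ≡ ι a * ι b
ι-∧ true b = sym (+-identityʳ (ι b))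
ι-∧ false b = refl

le-yes : ∀ {x y} → x ≤ y → le x y ≡ 1
le-yes = T⇒ι≡1 ∘ ≤⇒≤ᵇ

le-no : ∀ {x y} → y < x → le x y ≡ 0
le-no {x} {y} y<x = ¬T⇒ι≡0 (<⇒≱ y<x ∘ ≤ᵇ⇒≤ x y)

eq-yes : ∀ {x y} → x ≡ y → eq x y ≡ 1
eq-yes {x} {y} = T⇒ι≡1 ∘ ≡⇒≡ᵇ x y

eq-no : ∀ {x y} → x ≢ y → eq x y ≡ 0
eq-no {x} {y} x≢y = ¬T⇒ι≡0 (x≢y ∘ ≡ᵇ⇒≡ x y)

eq-shift : ∀ b x k → eq (b + x) (b + k) ≡ eq x k
eq-shift zero x k = refl
eq-shift (suc b) x k = eq-shift b x k

∑ : ℕ → (ℕ → ℕ) → ℕ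
∑ zero f = 0
∑ (suc n) f = f 0 + ∑ n (f ∘ suc)

∑-cong : ∀ n {f g} → (∀ i → i < n → f i ≡ g i) → ∑ n f ≡ ∑ n g
∑-cong zero e = refl
∑-cong (suc n) e = cong₂ _+_ (e 0 z<s) (∑-cong n (λ i i<n → e (suc i) (s<s i<n)))

∑-zero : ∀ n {f} → (∀ i → i < n → f i ≡ 0) → ∑ n f ≡ 0
∑-zero zero e = refl
∑-zero (suc n) e = cong₂ _+_ (e 0 z<s) (∑-zero n (λ i i<n → e (suc i) (s<s i<n)))

∑≡0⇒ : ∀ n {f} → ∑ n f ≡ 0 → ∀ i → i < n → f i ≡ 0
∑≡0⇒ (suc n) {f} e zero _ = m+n≡0⇒m≡0 (f 0) e
∑≡0⇒ (suc n) {f} e (suc i) (s≤s i<n) = ∑≡0⇒ n (m+n≡0⇒n≡0 (f 0) e) i i<n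

∑-+ : ∀ n f g → ∑ n (λ i → f i + g i) ≡ ∑ n f + ∑ n g
∑-+ zero f g = refl
∑-+ (suc n) f g rewrite ∑-+ n (f ∘ suc) (g ∘ suc) = +-interchange (f 0) (g 0) _ _

∑-*ˡ : ∀ n c f → ∑ n (λ i → c * f i) ≡ c * ∑ n f
∑-*ˡ zero c f = sym (*-zeroʳ c)
∑-*ˡ (suc n) c f rewrite ∑-*ˡ n c (f ∘ suc) = sym (*-distribˡ-+ c (f 0) _)

∑-const : ∀ n c → ∑ n (λ _ → c) ≡ n * c
∑-const zero c = refl
∑-const (suc n) c = cong (c +_) (∑-const n c)

∑-comm : ∀ m n (f : ℕ → ℕ → ℕ) → ∑ m (λ i → ∑ n (f i)) ≡ ∑ n (λ j → ∑ m (λ i → f i j))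
∑-comm zero n f = sym (∑-zero n (λ _ _ → refl))
∑-comm (suc m) n f rewrite ∑-comm m n (f ∘ suc) = sym (∑-+ n (f 0) _)

∑-split : ∀ m n f → ∑ (m + n) f ≡ ∑ m f + ∑ n (λ i → f (m + i))
∑-split zero n f = refl
∑-split (suc m) n f rewrite ∑-split m n (f ∘ suc) = sym (+-assoc (f 0) _ _)

∑-snoc : ∀ n f → ∑ (suc n) f ≡ ∑ n f + f n
∑-snoc zero f = +-identityʳ (f 0)
∑-snoc (suc n) f rewrite ∑-snoc n (f ∘ suc) = sym (+-assoc (f 0) _ _)

∑-extend : ∀ m n {f} → (∀ i → f (m + i) ≡ 0) → ∑ (m + n) f ≡ ∑ m f
∑-extend m n {f} e = trans (∑-split m n f) (trans (cong (∑ m f +_) (∑-zero n (λ i _ → e i))) (+-identityʳ _))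

∑-single : ∀ n j {f} → j < n → (∀ i → i < n → i ≢ j → f i ≡ 0) → ∑ n f ≡ f j
∑-single (suc n) zero {f} _ z =
  trans (cong (f 0 +_) (∑-zero n (λ i i<n → z (suc i) (s<s i<n) (λ ())))) (+-identityʳ _)
∑-single (suc n) (suc j) {f} (s≤s j<n) z =
  cong₂ _+_ (z 0 z<s (λ ())) (∑-single n j j<n (λ i i<n i≢j → z (suc i) (s<s i<n) (i≢j ∘ suc-injective)))

-- Balance equations stay in additive form throughout, since subtraction on `ℕ` truncates; this is
-- how they are summed over consecutive levels.
telescope : ∀ d (f X Y : ℕ → ℕ) → (∀ i → i < d → f i + X i ≡ f (suc i) + Y i) →
  f 0 + ∑ d X ≡ f d + ∑ d Y
telescope zero f X Y e = refl
telescope (suc d) f X Y e = begin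
  f 0 + (X 0 + ∑ d (X ∘ suc))     ≡⟨ +-assoc (f 0) _ _ ⟨
  (f 0 + X 0) + ∑ d (X ∘ suc)     ≡⟨ cong (_+ ∑ d (X ∘ suc)) (e 0 z<s) ⟩
  (f 1 + Y 0) + ∑ d (X ∘ suc)     ≡⟨ swap (f 1) (Y 0) _ ⟩
  Y 0 + (f 1 + ∑ d (X ∘ suc))     ≡⟨ cong (Y 0 +_) (telescope d (f ∘ suc) (X ∘ suc) (Y ∘ suc) (λ i i<d → e (suc i) (s<s i<d))) ⟩
  Y 0 + (f (suc d) + ∑ d (Y ∘ suc)) ≡⟨ swap′ (Y 0) (f (suc d)) _ ⟩
  f (suc d) + (Y 0 + ∑ d (Y ∘ suc)) ∎
  where
  open ≡-Reasoning
  swap : ∀ a b c → (a + b) + c ≡ b + (a + c)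
  swap = solve-∀
  swap′ : ∀ a b c → a + (b + c) ≡ b + (a + c)
  swap′ = solve-∀

sum-map-applyUpTo : ∀ {A : Set} (f : A → ℕ) (g : ℕ → A) n → sum (map f (applyUpTo g n)) ≡ ∑ n (f ∘ g)
sum-map-applyUpTo f g zero = refl
sum-map-applyUpTo f g (suc n) = cong (f (g 0) +_) (sum-map-applyUpTo f (g ∘ suc) n)

sum-map-++ : ∀ {A : Set} (f : A → ℕ) xs ys → sum (map f (xs ++ ys)) ≡ sum (map f xs) + sum (map f ys)
sum-map-++ f xs ys = trans (cong sum (map-++ f xs ys)) (sum-++ (map f xs) (map f ys))

sum-map-concatMap : ∀ {A B : Set} (f : B → ℕ) (g : A → List B) xs →
  sum (map f (concatMap g xs)) ≡ sum (map (λ x → sum (map f (g x))) xs)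
sum-map-concatMap f g [] = refl
sum-map-concatMap f g (x ∷ xs) =
  trans (sum-map-++ f (g x) (concatMap g xs)) (cong (sum (map f (g x)) +_) (sum-map-concatMap f g xs))

sum-map-map : ∀ {A B : Set} (f : B → ℕ) (g : A → B) xs → sum (map f (map g xs)) ≡ sum (map (f ∘ g) xs)
sum-map-map f g xs = cong sum (sym (map-∘ xs))

sum-map-cong : ∀ {A : Set} {f g : A → ℕ} → (∀ x → f x ≡ g x) → ∀ xs → sum (map f xs) ≡ sum (map g xs)
sum-map-cong e xs = cong sum (map-cong e xs)

sum-range1 : ∀ (f : ℕ → ℕ) n → sum (map f (range1 n)) ≡ ∑ n (f ∘ suc)
sum-range1 f n = trans (sum-map-map f suc (upTo n)) (sum-map-applyUpTo (f ∘ suc) id n)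

count≡sum : ∀ {A : Set} (p : A → Bool) xs → count p xs ≡ sum (map (ι ∘ p) xs)
count≡sum p [] = refl
count≡sum p (x ∷ xs) with p x
... | true = cong suc (count≡sum p xs)
... | false = count≡sum p xs

count-filter : ∀ {A : Set} (p q : A → Bool) xs →
  count p (filter (λ x → Data.Bool._≟_ (q x) true) xs) ≡ sum (map (λ x → ι (q x) * ι (p x)) xs)
count-filter p q [] = refl
count-filter p q (x ∷ xs) with q x
... | false = count-filter p q xs
... | true with p x
... | true = cong suc (count-filter p q xs)
... | false = count-filter p q xs

-- Sums over lists of fixed length with bounded entries.

∑ₗ : ℕ → ℕ → (List ℕ → ℕ) → ℕ
∑ₗ zero b F = F []
∑ₗ (suc N) b F = ∑ (suc b) (λ x → ∑ₗ N b (F ∘ (x ∷_)))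

sum-lists : ∀ N b F → sum (map F (lists N b)) ≡ ∑ₗ N b F
sum-lists zero b F = +-identityʳ _
sum-lists (suc N) b F = begin
  sum (map F (concatMap (λ x → map (x ∷_) (lists N b)) (upTo (suc b))))
    ≡⟨ sum-map-concatMap F (λ x → map (x ∷_) (lists N b)) (upTo (suc b)) ⟩
  sum (map (λ x → sum (map F (map (x ∷_) (lists N b)))) (upTo (suc b)))
    ≡⟨ sum-map-applyUpTo (λ x → sum (map F (map (x ∷_) (lists N b)))) id (suc b) ⟩
  ∑ (suc b) (λ x → sum (map F (map (x ∷_) (lists N b))))
    ≡⟨ ∑-cong (suc b) (λ x _ → trans (sum-map-map F (x ∷_) (lists N b)) (sum-lists N b (F ∘ (x ∷_)))) ⟩
  ∑ (suc b) (λ x → ∑ₗ N b (F ∘ (x ∷_))) ∎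
  where open ≡-Reasoning

∑ₗ-cong : ∀ N b {F G} → (∀ s → length s ≡ N → F s ≡ G s) → ∑ₗ N b F ≡ ∑ₗ N b G
∑ₗ-cong zero b e = e [] refl
∑ₗ-cong (suc N) b e = ∑-cong (suc b) (λ x _ → ∑ₗ-cong N b (λ s l → e (x ∷ s) (cong suc l)))

∑ₗ-zero : ∀ N b {F} → (∀ s → length s ≡ N → F s ≡ 0) → ∑ₗ N b F ≡ 0
∑ₗ-zero zero b e = e [] refl
∑ₗ-zero (suc N) b e = ∑-zero (suc b) (λ x _ → ∑ₗ-zero N b (λ s l → e (x ∷ s) (cong suc l)))

∑ₗ-∑-comm : ∀ N b n (F : List ℕ → ℕ → ℕ) → ∑ₗ N b (λ s → ∑ n (F s)) ≡ ∑ n (λ i → ∑ₗ N b (λ s → F s i))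
∑ₗ-∑-comm zero b n F = refl
∑ₗ-∑-comm (suc N) b n F =
  trans (∑-cong (suc b) (λ x _ → ∑ₗ-∑-comm N b n (F ∘ (x ∷_)))) (∑-comm (suc b) n (λ x i → ∑ₗ N b (λ s → F (x ∷ s) i)))

∑ₗ-+ : ∀ N b F G → ∑ₗ N b (λ s → F s + G s) ≡ ∑ₗ N b F + ∑ₗ N b G
∑ₗ-+ zero b F G = refl
∑ₗ-+ (suc N) b F G = trans (∑-cong (suc b) (λ x _ → ∑ₗ-+ N b (F ∘ (x ∷_)) (G ∘ (x ∷_)))) (∑-+ (suc b) (λ x → ∑ₗ N b (F ∘ (x ∷_))) (λ x → ∑ₗ N b (G ∘ (x ∷_))))

∑ₗ-*ʳ : ∀ N b F c → ∑ₗ N b (λ s → F s * c) ≡ ∑ₗ N b F * c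
∑ₗ-*ʳ zero b F c = refl
∑ₗ-*ʳ (suc N) b F c = begin
  ∑ (suc b) (λ x → ∑ₗ N b (λ s → F (x ∷ s) * c)) ≡⟨ ∑-cong (suc b) (λ x _ → trans (∑ₗ-*ʳ N b (F ∘ (x ∷_)) c) (*-comm (∑ₗ N b (F ∘ (x ∷_))) c)) ⟩
  ∑ (suc b) (λ x → c * ∑ₗ N b (F ∘ (x ∷_)))      ≡⟨ ∑-*ˡ (suc b) c (λ x → ∑ₗ N b (F ∘ (x ∷_))) ⟩
  c * ∑ₗ (suc N) b F                             ≡⟨ *-comm c _ ⟩
  ∑ₗ (suc N) b F * c                             ∎
  where open ≡-Reasoning

∑ₗ-snoc : ∀ N b F → ∑ₗ (suc N) b F ≡ ∑ₗ N b (λ s → ∑ (suc b) (λ x → F (s ++ [ x ])))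
∑ₗ-snoc zero b F = refl
∑ₗ-snoc (suc N) b F = ∑-cong (suc b) (λ y _ → ∑ₗ-snoc N b (F ∘ (y ∷_)))

∑ₗ-reverse : ∀ N b F → ∑ₗ N b F ≡ ∑ₗ N b (F ∘ reverse)
∑ₗ-reverse zero b F = refl
∑ₗ-reverse (suc N) b F = begin
  ∑ₗ (suc N) b F                                                ≡⟨ ∑ₗ-snoc N b F ⟩
  ∑ₗ N b (λ s → ∑ (suc b) (λ x → F (s ++ [ x ])))                ≡⟨ ∑ₗ-reverse N b _ ⟩
  ∑ₗ N b (λ s → ∑ (suc b) (λ x → F (reverse s ++ [ x ])))        ≡⟨ ∑ₗ-∑-comm N b (suc b) (λ s x → F (reverse s ++ [ x ])) ⟩
  ∑ (suc b) (λ x → ∑ₗ N b (λ s → F (reverse s ++ [ x ])))        ≡⟨ ∑-cong (suc b) (λ x _ → ∑ₗ-cong N b (λ s _ → cong F (sym (unfold-reverse x s)))) ⟩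
  ∑ₗ (suc N) b (F ∘ reverse)                                    ∎
  where open ≡-Reasoning

at-zero : ∀ s → at s 0 ≡ 0
at-zero [] = refl
at-zero (_ ∷ _) = refl

∑ₗ-single : ∀ b s₀ {F} → (∀ i → at s₀ i ≤ b) →
  (∀ s → length s ≡ length s₀ → s ≢ s₀ → F s ≡ 0) → ∑ₗ (length s₀) b F ≡ F s₀
∑ₗ-single b [] _ _ = refl
∑ₗ-single b (x ∷ s₀) {F} bd z =
  trans (∑-single (suc b) x (s≤s (bd 1))
          (λ y _ y≢x → ∑ₗ-zero (length s₀) b (λ s l → z (y ∷ s) (cong suc l) (λ { refl → y≢x refl }))))
        (∑ₗ-single b s₀ bd′ (λ s l s≢ → z (x ∷ s) (cong suc l) (λ { refl → s≢ refl })))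
  where
  bd′ : ∀ i → at s₀ i ≤ b
  bd′ (suc i) = bd (suc (suc i))
  bd′ zero = subst (_≤ b) (sym (at-zero s₀)) z≤n

-- An entry above `b` already exceeds the prescribed sum `A`. This allows the cap `n` on row lengths
-- to be raised to the larger one that the sum over paths requires.
∑ₗ-sum-bound : ∀ N A b k F → A ≤ b → (∀ s → sum s ≢ A → F s ≡ 0) → ∑ₗ N (b + k) F ≡ ∑ₗ N b F
∑ₗ-sum-bound zero A b k F _ _ = refl
∑ₗ-sum-bound (suc N) A b k F A≤b z = begin
  ∑ (suc b + k) (λ x → ∑ₗ N (b + k) (F ∘ (x ∷_)))
    ≡⟨ ∑-extend (suc b) k {λ x → ∑ₗ N (b + k) (F ∘ (x ∷_))} (λ i → ∑ₗ-zero N (b + k) (λ s _ → z (suc b + i ∷ s) (λ e →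
         <⇒≱ (s≤s (≤-trans A≤b (m≤m+n b i))) (≤-trans (m≤m+n _ (sum s)) (≤-reflexive e))))) ⟩
  ∑ (suc b) (λ x → ∑ₗ N (b + k) (F ∘ (x ∷_)))
    ≡⟨ ∑-cong (suc b) (λ x _ → go x) ⟩
  ∑ (suc b) (λ x → ∑ₗ N b (F ∘ (x ∷_))) ∎
  where
  open ≡-Reasoning
  go : ∀ x → ∑ₗ N (b + k) (F ∘ (x ∷_)) ≡ ∑ₗ N b (F ∘ (x ∷_))
  go x = ∑ₗ-sum-bound N (A ∸ x) b k (F ∘ (x ∷_)) (≤-trans (m∸n≤m A x) A≤b)
    (λ s ≢ → z (x ∷ s) (λ e → ≢ (sym (trans (cong (_∸ x) (sym e)) (m+n∸m≡n x (sum s))))))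

-- Polynomials in t up to equality of coefficients.

infix 4 _≈_
-- Lists that differ by trailing zeros stand for the same polynomial, so `≡` is too fine. The record
-- wrapper lets `p` and `q` be inferred, which the bare family of equations would not.
record _≈_ (p q : Poly) : Set where
  constructor coeffwise
  field coeffs : ∀ k → coeff k p ≡ coeff k q
open _≈_

≈-refl : ∀ {p} → p ≈ p
≈-refl = coeffwise λ _ → refl

≈-sym : ∀ {p q} → p ≈ q → q ≈ p
≈-sym e = coeffwise λ k → sym (coeffs e k)

≈-trans : ∀ {p q r} → p ≈ q → q ≈ r → p ≈ r
≈-trans e f = coeffwise λ k → trans (coeffs e k) (coeffs f k)

≈-setoid : Setoid _ _
≈-setoid = record { Carrier = Poly ; _≈_ = _≈_
  ; isEquivalence = record { refl = ≈-refl ; sym = ≈-sym ; trans = ≈-trans } }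

module ≈-Reasoning = SetoidReasoning ≈-setoid

coeff-⊕ : ∀ k p q → coeff k (p ⊕ q) ≡ coeff k p + coeff k q
coeff-⊕ k [] q = refl
coeff-⊕ k (a ∷ p) [] = sym (+-identityʳ _)
coeff-⊕ zero (a ∷ p) (b ∷ q) = refl
coeff-⊕ (suc k) (a ∷ p) (b ∷ q) = coeff-⊕ k p q

coeff-scale : ∀ k a q → coeff k (map (a *_) q) ≡ a * coeff k q
coeff-scale k a [] = sym (*-zeroʳ a)
coeff-scale zero a (b ∷ q) = refl
coeff-scale (suc k) a (b ∷ q) = coeff-scale k a q

coeff-⊗ : ∀ k p q → coeff k (p ⊗ q) ≡ ∑ (suc k) (λ i → coeff i p * coeff (k ∸ i) q)
coeff-⊗ k [] q = sym (∑-zero (suc k) (λ _ _ → refl))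
coeff-⊗ k (a ∷ p) q = trans (coeff-⊕ k (map (a *_) q) (0 ∷ (p ⊗ q))) (cong₂ _+_ (coeff-scale k a q) (tail k))
  where
  tail : ∀ k → coeff k (0 ∷ (p ⊗ q)) ≡ ∑ k (λ i → coeff i p * coeff (k ∸ suc i) q)
  tail zero = refl
  tail (suc k) = coeff-⊗ k p q

⊕-cong : ∀ {p p′ q q′} → p ≈ p′ → q ≈ q′ → p ⊕ q ≈ p′ ⊕ q′
⊕-cong {p} {p′} {q} {q′} e f = coeffwise λ k →
  trans (coeff-⊕ k p q) (trans (cong₂ _+_ (coeffs e k) (coeffs f k)) (sym (coeff-⊕ k p′ q′)))

⊗-cong : ∀ {p p′ q q′} → p ≈ p′ → q ≈ q′ → p ⊗ q ≈ p′ ⊗ q′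
⊗-cong {p} {p′} {q} {q′} e f = coeffwise λ k →
  trans (coeff-⊗ k p q)
    (trans (∑-cong (suc k) (λ i _ → cong₂ _*_ (coeffs e i) (coeffs f (k ∸ i)))) (sym (coeff-⊗ k p′ q′)))

⊕-interchange : ∀ p q r s → (p ⊕ q) ⊕ (r ⊕ s) ≈ (p ⊕ r) ⊕ (q ⊕ s)
⊕-interchange p q r s = coeffwise λ k → trans (expand k p q r s)
  (trans (+-interchange (coeff k p) (coeff k q) (coeff k r) (coeff k s)) (sym (expand k p r q s)))
  where
  expand : ∀ k p q r s → coeff k ((p ⊕ q) ⊕ (r ⊕ s)) ≡ (coeff k p + coeff k q) + (coeff k r + coeff k s)
  expand k p q r s = trans (coeff-⊕ k (p ⊕ q) (r ⊕ s)) (cong₂ _+_ (coeff-⊕ k p q) (coeff-⊕ k r s))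

⊗-distribʳ : ∀ p q r → (p ⊕ q) ⊗ r ≈ (p ⊗ r) ⊕ (q ⊗ r)
⊗-distribʳ p q r = coeffwise λ k → begin
  coeff k ((p ⊕ q) ⊗ r)
    ≡⟨ coeff-⊗ k (p ⊕ q) r ⟩
  ∑ (suc k) (λ i → coeff i (p ⊕ q) * coeff (k ∸ i) r)
    ≡⟨ ∑-cong (suc k) (λ i _ → trans (cong (_* coeff (k ∸ i) r) (coeff-⊕ i p q)) (*-distribʳ-+ _ (coeff i p) _)) ⟩
  ∑ (suc k) (λ i → coeff i p * coeff (k ∸ i) r + coeff i q * coeff (k ∸ i) r)
    ≡⟨ ∑-+ (suc k) (λ i → coeff i p * coeff (k ∸ i) r) (λ i → coeff i q * coeff (k ∸ i) r) ⟩
  ∑ (suc k) (λ i → coeff i p * coeff (k ∸ i) r) + ∑ (suc k) (λ i → coeff i q * coeff (k ∸ i) r)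
    ≡⟨ cong₂ _+_ (coeff-⊗ k p r) (coeff-⊗ k q r) ⟨
  coeff k (p ⊗ r) + coeff k (q ⊗ r)
    ≡⟨ coeff-⊕ k (p ⊗ r) (q ⊗ r) ⟨
  coeff k ((p ⊗ r) ⊕ (q ⊗ r)) ∎
  where open ≡-Reasoning

⊗-distribˡ : ∀ p q r → p ⊗ (q ⊕ r) ≈ (p ⊗ q) ⊕ (p ⊗ r)
⊗-distribˡ p q r = coeffwise λ k → begin
  coeff k (p ⊗ (q ⊕ r))
    ≡⟨ coeff-⊗ k p (q ⊕ r) ⟩
  ∑ (suc k) (λ i → coeff i p * coeff (k ∸ i) (q ⊕ r))
    ≡⟨ ∑-cong (suc k) (λ i _ → trans (cong (coeff i p *_) (coeff-⊕ (k ∸ i) q r)) (*-distribˡ-+ (coeff i p) (coeff (k ∸ i) q) _)) ⟩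
  ∑ (suc k) (λ i → coeff i p * coeff (k ∸ i) q + coeff i p * coeff (k ∸ i) r)
    ≡⟨ ∑-+ (suc k) (λ i → coeff i p * coeff (k ∸ i) q) (λ i → coeff i p * coeff (k ∸ i) r) ⟩
  ∑ (suc k) (λ i → coeff i p * coeff (k ∸ i) q) + ∑ (suc k) (λ i → coeff i p * coeff (k ∸ i) r)
    ≡⟨ cong₂ _+_ (coeff-⊗ k p q) (coeff-⊗ k p r) ⟨
  coeff k (p ⊗ q) + coeff k (p ⊗ r)
    ≡⟨ coeff-⊕ k (p ⊗ q) (p ⊗ r) ⟨
  coeff k ((p ⊗ q) ⊕ (p ⊗ r)) ∎
  where open ≡-Reasoning

0∷-cong : ∀ {p q} → p ≈ q → (0 ∷ p) ≈ (0 ∷ q)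
0∷-cong e = coeffwise λ { zero → refl ; (suc k) → coeffs e k }

tpow*-cong : ∀ b {p q} → p ≈ q → tpow* b p ≈ tpow* b q
tpow*-cong zero e = e
tpow*-cong (suc b) e = 0∷-cong (tpow*-cong b e)

0∷-⊗ : ∀ p q → (0 ∷ p) ⊗ q ≈ (0 ∷ (p ⊗ q))
0∷-⊗ p q = coeffwise λ k →
  trans (coeff-⊕ k (map (0 *_) q) (0 ∷ (p ⊗ q))) (cong (_+ coeff k (0 ∷ (p ⊗ q))) (coeff-scale k 0 q))

⊗-0∷ : ∀ p q → p ⊗ (0 ∷ q) ≈ (0 ∷ (p ⊗ q))
⊗-0∷ [] q = coeffwise λ { zero → refl ; (suc k) → refl }
⊗-0∷ (a ∷ p) q = coeffwise λ
  { zero → trans (+-identityʳ _) (*-zeroʳ a)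
  ; (suc k) → coeffs (⊕-cong {map (a *_) q} ≈-refl (⊗-0∷ p q)) k }

tpow*-⊗ : ∀ b p q → tpow* b p ⊗ q ≈ tpow* b (p ⊗ q)
tpow*-⊗ zero p q = ≈-refl
tpow*-⊗ (suc b) p q = ≈-trans (0∷-⊗ (tpow* b p) q) (0∷-cong (tpow*-⊗ b p q))

⊗-tpow* : ∀ b p q → p ⊗ tpow* b q ≈ tpow* b (p ⊗ q)
⊗-tpow* zero p q = ≈-refl
⊗-tpow* (suc b) p q = ≈-trans (⊗-0∷ p (tpow* b q)) (0∷-cong (⊗-tpow* b p q))

tpow*-⊕ : ∀ b p q → tpow* b (p ⊕ q) ≈ tpow* b p ⊕ tpow* b q
tpow*-⊕ zero p q = ≈-refl
tpow*-⊕ (suc b) p q = 0∷-cong (tpow*-⊕ b p q)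

tpow*-+ : ∀ a b p → tpow* a (tpow* b p) ≡ tpow* (a + b) p
tpow*-+ zero b p = refl
tpow*-+ (suc a) b p = cong (0 ∷_) (tpow*-+ a b p)

coeff-tpow* : ∀ b k p → coeff (b + k) (tpow* b p) ≡ coeff k p
coeff-tpow* zero k p = refl
coeff-tpow* (suc b) k p = coeff-tpow* b k p

coeff-tpow*-< : ∀ b k p → k < b → coeff k (tpow* b p) ≡ 0
coeff-tpow*-< (suc b) zero p _ = refl
coeff-tpow*-< (suc b) (suc k) p (s≤s k<b) = coeff-tpow*-< b k p k<b

tpow*-[] : ∀ b → tpow* b [] ≈ []
tpow*-[] zero = ≈-refl
tpow*-[] (suc b) = ≈-trans (0∷-cong (tpow*-[] b)) (coeffwise λ { zero → refl ; (suc k) → refl })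

⊕-[] : ∀ p → p ⊕ [] ≈ p
⊕-[] p = coeffwise λ k → trans (coeff-⊕ k p []) (+-identityʳ _)

⊗-zeroʳ : ∀ p → p ⊗ [] ≈ []
⊗-zeroʳ p = coeffwise λ k → trans (coeff-⊗ k p []) (∑-zero (suc k) (λ i _ → *-zeroʳ (coeff i p)))

⊗-identityˡ : ∀ p → one ⊗ p ≈ p
⊗-identityˡ p = coeffwise λ k → begin
  coeff k (map (1 *_) p ⊕ (0 ∷ []))        ≡⟨ coeff-⊕ k (map (1 *_) p) (0 ∷ []) ⟩
  coeff k (map (1 *_) p) + coeff k (0 ∷ []) ≡⟨ cong₂ _+_ (trans (coeff-scale k 1 p) (+-identityʳ _)) (coeffs (tpow*-[] 1) k) ⟩
  coeff k p + 0                            ≡⟨ +-identityʳ _ ⟩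
  coeff k p                                ∎
  where open ≡-Reasoning

-- Gaussian binomials and words ending in E.

gaussℕ-zeroʳ : ∀ a → gaussℕ a 0 ≡ one
gaussℕ-zeroʳ zero = refl
gaussℕ-zeroʳ (suc a) = refl

gaussℕ-> : ∀ a b → a < b → gaussℕ a b ≈ []
gaussℕ-> zero (suc b) _ = ≈-refl
gaussℕ-> (suc a) (suc b) (s≤s a<b) =
  ≈-trans (⊕-cong (gaussℕ-> a b a<b)
            (≈-trans (tpow*-cong (suc b) (gaussℕ-> a (suc b) (m<n⇒m<1+n a<b))) (tpow*-[] (suc b))))
          ≈-refl

gaussℕ-diag : ∀ a → gaussℕ a a ≈ one
gaussℕ-diag zero = ≈-refl
gaussℕ-diag (suc a) =
  ≈-trans (⊕-cong (gaussℕ-diag a)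
            (≈-trans (tpow*-cong (suc a) (gaussℕ-> a (suc a) (n<1+n a))) (tpow*-[] (suc a))))
          (⊕-[] one)

-- The other t-Pascal rule, with the power of t on the first term. Both terms of the defining rule
-- are expanded by induction and regrouped, using (k + 2) + j = (j + 1) + (k + 1). Writing the upper
-- entry as `j + k` keeps the exponent free of subtraction.
gaussℕ-pascal : ∀ j k → gaussℕ (suc (j + k)) (suc k) ≈ tpow* j (gaussℕ (j + k) k) ⊕ gaussℕ (j + k) (suc k)
gaussℕ-pascal zero k = ⊕-cong {gaussℕ k k} ≈-refl
  (≈-trans (tpow*-cong (suc k) z) (≈-trans (tpow*-[] (suc k)) (≈-sym z)))
  where
  z : gaussℕ k (suc k) ≈ []
  z = gaussℕ-> k (suc k) (n<1+n k)
gaussℕ-pascal (suc j) zero = begin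
  one ⊕ tpow* 1 (gaussℕ (suc n) 1)
    ≈⟨ ⊕-cong {one} ≈-refl (tpow*-cong 1 IH) ⟩
  ([] ⊕ one) ⊕ (tpow* (suc j) one ⊕ tpow* 1 (gaussℕ n 1))
    ≈⟨ ⊕-interchange [] one (tpow* (suc j) one) (tpow* 1 (gaussℕ n 1)) ⟩
  tpow* (suc j) one ⊕ (one ⊕ tpow* 1 (gaussℕ n 1))
    ≡⟨ cong (λ p → tpow* (suc j) one ⊕ (p ⊕ tpow* 1 (gaussℕ n 1))) (gaussℕ-zeroʳ n) ⟨
  tpow* (suc j) one ⊕ gaussℕ (suc n) 1 ∎
  where
  open ≈-Reasoning
  n = j + 0
  IH : gaussℕ (suc n) 1 ≈ tpow* j one ⊕ gaussℕ n 1
  IH = subst (λ p → gaussℕ (suc n) 1 ≈ tpow* j p ⊕ gaussℕ n 1) (gaussℕ-zeroʳ n) (gaussℕ-pascal j 0)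
gaussℕ-pascal (suc j) (suc k) = begin
  gaussℕ (suc n) (suc k) ⊕ tpow* (2 + k) (gaussℕ (suc n) (2 + k))
    ≈⟨ ⊕-cong (subst (λ c → gaussℕ (suc c) (suc k) ≈ tpow* (suc j) (gaussℕ c k) ⊕ gaussℕ c (suc k))
                (sym (+-suc j k)) (gaussℕ-pascal (suc j) k))
              (tpow*-cong (2 + k) (gaussℕ-pascal j (suc k))) ⟩
  (tpow* (suc j) G₀ ⊕ G₁) ⊕ tpow* (2 + k) (tpow* j G₁ ⊕ G₂)
    ≈⟨ ⊕-cong {tpow* (suc j) G₀ ⊕ G₁} ≈-refl (tpow*-⊕ (2 + k) (tpow* j G₁) G₂) ⟩
  (tpow* (suc j) G₀ ⊕ G₁) ⊕ (tpow* (2 + k) (tpow* j G₁) ⊕ tpow* (2 + k) G₂)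
    ≈⟨ ⊕-interchange (tpow* (suc j) G₀) G₁ (tpow* (2 + k) (tpow* j G₁)) (tpow* (2 + k) G₂) ⟩
  (tpow* (suc j) G₀ ⊕ tpow* (2 + k) (tpow* j G₁)) ⊕ gaussℕ (suc n) (2 + k)
    ≡⟨ cong (λ p → (tpow* (suc j) G₀ ⊕ p) ⊕ gaussℕ (suc n) (2 + k)) exponents ⟩
  (tpow* (suc j) G₀ ⊕ tpow* (suc j) (tpow* (suc k) G₁)) ⊕ gaussℕ (suc n) (2 + k)
    ≈⟨ ⊕-cong (tpow*-⊕ (suc j) G₀ (tpow* (suc k) G₁)) (≈-refl {gaussℕ (suc n) (2 + k)}) ⟨
  tpow* (suc j) (gaussℕ (suc n) (suc k)) ⊕ gaussℕ (suc n) (2 + k) ∎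
  where
  open ≈-Reasoning
  n = j + suc k
  G₀ = gaussℕ n k
  G₁ = gaussℕ n (suc k)
  G₂ = gaussℕ n (2 + k)
  comm : ∀ k j → 2 + k + j ≡ suc j + suc k
  comm = solve-∀
  exponents : tpow* (2 + k) (tpow* j G₁) ≡ tpow* (suc j) (tpow* (suc k) G₁)
  exponents = trans (tpow*-+ (2 + k) j G₁) (trans (cong (λ c → tpow* c G₁) (comm k j)) (sym (tpow*-+ (suc j) (suc k) G₁)))

-- The t-count, by inversions, of the words in a letters E and b letters N that end in E.
words : ℕ → ℕ → Poly
words zero zero = one
words zero (suc b) = []
words (suc a) b = gaussℕ (a + b) a

words-zeroʳ : ∀ a → words a 0 ≈ one
words-zeroʳ zero = ≈-refl
words-zeroʳ (suc a) rewrite +-identityʳ a = gaussℕ-diag a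

-- By the first letter: a leading E makes an inversion with each of the `suc b` letters N behind it,
-- a leading N makes none.
words-rec : ∀ a b → words (suc a) (suc b) ≈ tpow* (suc b) (words a (suc b)) ⊕ words (suc a) b
words-rec zero b = begin
  one                             ≡⟨ gaussℕ-zeroʳ b ⟨
  gaussℕ b 0                      ≈⟨ ⊕-cong (tpow*-[] (suc b)) ≈-refl ⟨
  tpow* (suc b) [] ⊕ gaussℕ b 0   ∎
  where open ≈-Reasoning
words-rec (suc a) b = subst₂ (λ c c′ → gaussℕ (suc c′) (suc a) ≈ tpow* (suc b) (gaussℕ c′ a) ⊕ gaussℕ c (suc a))
  (trans (comm b a) (+-suc a b)) (comm b a) (gaussℕ-pascal (suc b) a)
  where
  comm : ∀ b a → suc b + a ≡ a + suc b
  comm = solve-∀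

-- Products of polynomials over an interval of levels.

∏ : ℕ → ℕ → (ℕ → Poly) → Poly
∏ o zero f = one
∏ o (suc K) f = f o ⊗ ∏ (suc o) K f

∏-cong : ∀ o K {f g} → (∀ L → o ≤ L → L < o + K → f L ≈ g L) → ∏ o K f ≈ ∏ o K g
∏-cong o zero e = ≈-refl
∏-cong o (suc K) e = ⊗-cong (e o ≤-refl (m<m+n o z<s))
  (∏-cong (suc o) K (λ L o<L L< → e L (<⇒≤ o<L) (subst (L <_) (sym (+-suc o K)) L<)))

∏-one : ∀ o K {f} → (∀ L → o ≤ L → f L ≈ one) → ∏ o K f ≈ one
∏-one o zero e = ≈-refl
∏-one o (suc K) e = ≈-trans (⊗-cong (e o ≤-refl) (∏-one (suc o) K (λ L o<L → e L (<⇒≤ o<L)))) (⊗-identityˡ one)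

∏-dropˡ : ∀ o m K {f} → (∀ L → L < o + m → f L ≈ one) → ∏ o (m + K) f ≈ ∏ (o + m) K f
∏-dropˡ o zero K e rewrite +-identityʳ o = ≈-refl
∏-dropˡ o (suc m) K {f} e rewrite +-suc o m =
  ≈-trans (⊗-cong (e o (s≤s (m≤m+n o m))) (∏-dropˡ (suc o) m K e)) (⊗-identityˡ _)

∏-dropʳ : ∀ o K m {f} → (∀ L → o + K ≤ L → f L ≈ one) → ∏ o (K + m) f ≈ ∏ o K f
∏-dropʳ o zero m e = ∏-one o m (λ L o≤L → e L (subst (_≤ L) (sym (+-identityʳ o)) o≤L))
∏-dropʳ o (suc K) m {f} e = ⊗-cong {f o} ≈-refl (∏-dropʳ (suc o) K m (λ L l → e L (subst (_≤ L) (sym (+-suc o K)) l)))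

-- A step of the path changes only the factor of the level that it leaves, so the rule for that one
-- factor passes to the whole product.
∏-linear : ∀ o K v β {f f′ f″} → o ≤ v → v < o + K →
  (∀ L → L ≢ v → f L ≈ f′ L) → (∀ L → L ≢ v → f L ≈ f″ L) →
  f v ≈ tpow* β (f′ v) ⊕ f″ v → ∏ o K f ≈ tpow* β (∏ o K f′) ⊕ ∏ o K f″
∏-linear o zero v β o≤v v<o _ _ _ = ⊥-elim (<⇒≱ v<o (subst (_≤ v) (sym (+-identityʳ o)) o≤v))
∏-linear o (suc K) v β {f} {f′} {f″} o≤v v< e′ e″ ev with o ≟ v
... | yes refl = begin
  f o ⊗ ∏ (suc o) K f                       ≈⟨ ⊗-cong ev (∏-cong (suc o) K (λ L o<L _ → e′ L (λ { refl → <-irrefl refl o<L }))) ⟩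
  (tpow* β (f′ o) ⊕ f″ o) ⊗ R′              ≈⟨ ⊗-distribʳ (tpow* β (f′ o)) (f″ o) R′ ⟩
  (tpow* β (f′ o) ⊗ R′) ⊕ (f″ o ⊗ R′)       ≈⟨ ⊕-cong (tpow*-⊗ β (f′ o) R′) (⊗-cong {f″ o} ≈-refl (∏-cong (suc o) K same)) ⟩
  tpow* β (f′ o ⊗ R′) ⊕ (f″ o ⊗ R″)         ∎
  where
  open ≈-Reasoning
  R′ = ∏ (suc o) K f′
  R″ = ∏ (suc o) K f″
  same : ∀ L → suc o ≤ L → L < suc o + K → f′ L ≈ f″ L
  same L o<L _ = ≈-trans (≈-sym (e′ L (λ { refl → <-irrefl refl o<L }))) (e″ L (λ { refl → <-irrefl refl o<L }))
... | no o≢v = begin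
  f o ⊗ ∏ (suc o) K f                       ≈⟨ ⊗-cong {f o} ≈-refl (∏-linear (suc o) K v β (≤∧≢⇒< o≤v o≢v) (subst (v <_) (+-suc o K) v<) e′ e″ ev) ⟩
  f o ⊗ (tpow* β R′ ⊕ R″)                   ≈⟨ ⊗-distribˡ (f o) (tpow* β R′) R″ ⟩
  (f o ⊗ tpow* β R′) ⊕ (f o ⊗ R″)           ≈⟨ ⊕-cong (⊗-tpow* β (f o) R′) ≈-refl ⟩
  tpow* β (f o ⊗ R′) ⊕ (f o ⊗ R″)           ≈⟨ ⊕-cong (tpow*-cong β (⊗-cong (e′ o o≢v) ≈-refl)) (⊗-cong (e″ o o≢v) ≈-refl) ⟩
  tpow* β (f′ o ⊗ R′) ⊕ (f″ o ⊗ R″)         ∎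
  where
  open ≈-Reasoning
  R′ = ∏ (suc o) K f′
  R″ = ∏ (suc o) K f″

-- Boundary paths and the sum over the paths with given levels.

le-suc : ∀ u L → le u L + eq u (suc L) ≡ le u (suc L)
le-suc u L with <-cmp u (suc L)
... | tri< u<sL u≢sL _ = trans (cong₂ _+_ (le-yes (s≤s⁻¹ u<sL)) (eq-no u≢sL)) (sym (le-yes (<⇒≤ u<sL)))
... | tri≈ _ refl _ = trans (cong₂ _+_ (le-no {suc L} {L} ≤-refl) (eq-yes {suc L} refl)) (sym (le-yes {suc L} ≤-refl))
... | tri> _ u≢sL sL<u = trans (cong₂ _+_ (le-no (<-trans (n<1+n L) sL<u)) (eq-no u≢sL)) (sym (le-no sL<u))

le-+ : ∀ d u L → le u L + ∑ d (λ i → eq u (suc L + i)) ≡ le u (L + d)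
le-+ zero u L = trans (+-identityʳ _) (cong (le u) (sym (+-identityʳ L)))
le-+ (suc d) u L = begin
  le u L + ∑ (suc d) (λ i → eq u (suc L + i))                ≡⟨ cong (le u L +_) (∑-snoc d (λ i → eq u (suc L + i))) ⟩
  le u L + (∑ d (λ i → eq u (suc L + i)) + eq u (suc L + d)) ≡⟨ +-assoc (le u L) _ _ ⟨
  le u L + ∑ d (λ i → eq u (suc L + i)) + eq u (suc L + d)   ≡⟨ cong (_+ eq u (suc L + d)) (le-+ d u L) ⟩
  le u (L + d) + eq u (suc (L + d))                          ≡⟨ le-suc u (L + d) ⟩
  le u (suc (L + d))                                         ≡⟨ cong (le u) (+-suc L d) ⟨
  le u (L + suc d)                                           ∎
  where open ≡-Reasoning

le-cancel : ∀ d u L → le (u + d) (L + d) ≡ le u L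
le-cancel d u L with u ≤? L
... | yes u≤L = trans (le-yes (+-monoˡ-≤ d u≤L)) (sym (le-yes u≤L))
... | no u≰L = trans (le-no (+-monoˡ-< d (≰⇒> u≰L))) (sym (le-no (≰⇒> u≰L)))

positive : ℕ → ℕ
positive zero = 0
positive (suc _) = 1

-- A partition with r rows is encoded by its rows ν, read from the bottom.  The row
-- of length y that is i-th from the top has level d i + y: this is the level of the
-- N-step at its end when the boundary path is read from the bottom left corner.

Chain : ℕ → List ℕ → Set
Chain x [] = ⊤
Chain x (z ∷ ν) = x ≤ z × Chain z ν

-- Sum over the weakly increasing lists of length r with entries between x and x + c.
∑↗ : ℕ → ℕ → ℕ → (List ℕ → ℕ) → ℕ
∑↗ zero x c F = F []
∑↗ (suc r) x zero F = ∑↗ r x zero (F ∘ (x ∷_))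
∑↗ (suc r) x (suc c) F = ∑↗ r x (suc c) (F ∘ (x ∷_)) + ∑↗ (suc r) (suc x) c F

Chain-weaken : ∀ {x y} ν → x ≤ y → Chain y ν → Chain x ν
Chain-weaken [] _ _ = tt
Chain-weaken (z ∷ ν) x≤y (y≤z , ch) = ≤-trans x≤y y≤z , ch

∑↗-cong : ∀ r x c {F G} → (∀ ν → length ν ≡ r → Chain x ν → F ν ≡ G ν) → ∑↗ r x c F ≡ ∑↗ r x c G
∑↗-cong zero x c e = e [] refl tt
∑↗-cong (suc r) x zero e = ∑↗-cong r x zero (λ ν l ch → e (x ∷ ν) (cong suc l) (≤-refl , ch))
∑↗-cong (suc r) x (suc c) e = cong₂ _+_
  (∑↗-cong r x (suc c) (λ ν l ch → e (x ∷ ν) (cong suc l) (≤-refl , ch)))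
  (∑↗-cong (suc r) (suc x) c (λ ν l ch → e ν l (Chain-weaken ν (n≤1+n x) ch)))

∑↗-0 : ∀ r x c → ∑↗ r x c (λ _ → 0) ≡ 0
∑↗-0 zero x c = refl
∑↗-0 (suc r) x zero = ∑↗-0 r x zero
∑↗-0 (suc r) x (suc c) = cong₂ _+_ (∑↗-0 r x (suc c)) (∑↗-0 (suc r) (suc x) c)

∑↗-zero : ∀ r x c {F} → (∀ ν → length ν ≡ r → Chain x ν → F ν ≡ 0) → ∑↗ r x c F ≡ 0
∑↗-zero r x c e = trans (∑↗-cong r x c e) (∑↗-0 r x c)

rowsum : (ℕ → ℕ → ℕ) → List ℕ → ℕ
rowsum f [] = 0
rowsum f (z ∷ ν) = f (suc (length ν)) z + rowsum f ν

module Paths (d : ℕ) where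

  levels : List ℕ → ℕ → ℕ
  levels ν L = rowsum (λ i y → eq (d * i + y) L) ν

  -- The number of cells with a + 1 = d l, column by column: such a cell pairs the E-step
  -- at the foot of its column with a later N-step of the same level.
  hook : ℕ → List ℕ → ℕ
  hook x [] = 0
  hook x (z ∷ ν) = ∑ (z ∸ x) (λ w → levels (z ∷ ν) (d * suc (length ν) + (x + w))) + hook z ν

  -- Removing an absent element would leave `b` as it is; the factor `positive` in `hasLevels`
  -- excludes that case.
  remove : ℕ → (ℕ → ℕ) → ℕ → ℕ
  remove v b L = b L ∸ eq v L

  -- Indicator of levels ν being b, assuming that b has as many elements as ν.
  hasLevels : (ℕ → ℕ) → List ℕ → ℕ
  hasLevels b [] = 1
  hasLevels b (z ∷ ν) = positive (b v) * hasLevels (remove v b) ν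
    where v = d * suc (length ν) + z

  -- The number of E-steps at level L on a path that starts at level v and has N-steps at
  -- the levels b; it is read off from the flow through the cut between L and L + 1.
  esteps : ℕ → (ℕ → ℕ) → ℕ → ℕ
  esteps v b L = le v L + ∑ d (λ i → b (suc L + i))

  -- The choices for the word of steps that leave `L`. It is 1 wherever `b` is 0, so a product up to
  -- any bound for `b` is the full product.
  weight : ℕ → (ℕ → ℕ) → ℕ → Poly
  weight v b L = words (esteps v b L) (b L)

  remove-at : ∀ v b → remove v b v ≡ b v ∸ 1
  remove-at v b = cong (b v ∸_) (eq-yes {v} refl)

  remove-off : ∀ {v L} b → L ≢ v → remove v b L ≡ b L
  remove-off {v} {L} b L≢v = cong (b L ∸_) (eq-no (L≢v ∘ sym))

  remove-+ : ∀ {v B} b → b v ≡ suc B → ∀ L → b L ≡ remove v b L + eq v L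
  remove-+ {v} {B} b e L with v ≟ L
  ... | yes refl = sym (m∸n+n≡m (subst₂ _≤_ (sym (eq-yes {v} refl)) (sym e) (s≤s z≤n)))
  ... | no v≢L = sym (trans (cong (remove v b L +_) (eq-no v≢L)) (trans (+-identityʳ _) (remove-off b (v≢L ∘ sym))))

  ∑-eq : ∀ M v → v < M → ∑ M (eq v) ≡ 1
  ∑-eq M v v<M = trans (∑-single M v v<M (λ i _ i≢v → eq-no (i≢v ∘ sym))) (eq-yes {v} refl)

  ∑-remove : ∀ M {v B r} b → b v ≡ suc B → v < M → ∑ M b ≡ suc r → ∑ M (remove v b) ≡ r
  ∑-remove M {v} {B} {r} b e v<M s = suc-injective (begin
    suc (∑ M (remove v b))                   ≡⟨ +-comm 1 _ ⟩
    ∑ M (remove v b) + 1                     ≡⟨ cong (∑ M (remove v b) +_) (∑-eq M v v<M) ⟨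
    ∑ M (remove v b) + ∑ M (eq v)            ≡⟨ ∑-+ M (remove v b) (eq v) ⟨
    ∑ M (λ L → remove v b L + eq v L)        ≡⟨ ∑-cong M (λ L _ → remove-+ b e L) ⟨
    ∑ M b                                    ≡⟨ s ⟩
    suc r                                    ∎)
    where open ≡-Reasoning

  remove-bound : ∀ {M v} b → (∀ L → M ≤ L → b L ≡ 0) → ∀ L → M ≤ L → remove v b L ≡ 0
  remove-bound {v = v} b z L M≤L = trans (cong (_∸ eq v L) (z L M≤L)) (0∸n≡0 (eq v L))

  -- Each successful test takes one element out of `b`, so after `length ν` of them the total below
  -- `M` is 0 and nothing is left over.
  hasLevels-sound : ∀ M b ν → ∑ M b ≡ length ν → (∀ L → M ≤ L → b L ≡ 0) →
    hasLevels b ν ≡ 0 ⊎ (hasLevels b ν ≡ 1 × (∀ L → b L ≡ levels ν L))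
  hasLevels-sound M b [] s z = inj₂ (refl , go)
    where
    go : ∀ L → b L ≡ 0
    go L with M ≤? L
    ... | yes M≤L = z L M≤L
    ... | no M≰L = ∑≡0⇒ M s L (≰⇒> M≰L)
  hasLevels-sound M b (y ∷ ν) s z with b (d * suc (length ν) + y) in e
  ... | zero = inj₁ refl
  ... | suc B with hasLevels-sound M (remove v b) ν (∑-remove M b e v<M s) (remove-bound {v = d * suc (length ν) + y} b z)
    where
    v = d * suc (length ν) + y
    v<M : v < M
    v<M = ≰⇒> (λ M≤v → 0≢1+n (trans (sym (z v M≤v)) e))
  ...   | inj₁ h = inj₁ (trans (+-identityʳ _) h)
  ...   | inj₂ (h , f) = inj₂ (trans (+-identityʳ _) h , λ L → trans (remove-+ b e L) (trans (+-comm _ (eq v L)) (cong (eq v L +_) (f L))))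
    where v = d * suc (length ν) + y

  hasLevels-complete : ∀ b ν → (∀ L → b L ≡ levels ν L) → hasLevels b ν ≡ 1
  hasLevels-complete b [] f = refl
  hasLevels-complete b (y ∷ ν) f = cong₂ _*_ (cong positive bv)
    (hasLevels-complete (remove v b) ν (λ L → trans (cong (_∸ eq v L) (f L)) (m+n∸m≡n (eq v L) _)))
    where
    v = d * suc (length ν) + y
    bv : b v ≡ suc (levels ν v)
    bv = trans (f v) (cong (_+ levels ν v) (eq-yes {v} refl))

  hasLevels-∉ : ∀ b y ν → b (d * suc (length ν) + y) ≡ 0 → hasLevels b (y ∷ ν) ≡ 0
  hasLevels-∉ b y ν e = cong (λ p → positive p * hasLevels (remove (d * suc (length ν) + y) b) ν) e

  hasLevels-∷ : ∀ {B u} b y ν → d * suc (length ν) + y ≡ u → b u ≡ suc B →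
    hasLevels b (y ∷ ν) ≡ hasLevels (remove u b) ν
  hasLevels-∷ b y ν refl e = trans (cong (λ p → positive p * hasLevels (remove (d * suc (length ν) + y) b) ν) e) (+-identityʳ _)

  -- An N-step does not change how many E-steps are still to come: at the cuts between `w` and
  -- `w + d` one downward crossing is lost, but the start now lies below the cut.
  esteps-remove : ∀ w {B} b L → b (w + d) ≡ suc B →
    esteps (w + d) b L ≡ esteps w (remove (w + d) b) L
  esteps-remove w b L e = begin
    le v L + ∑ d (λ i → b (suc L + i))
      ≡⟨ cong (le v L +_) (∑-cong d (λ i _ → trans (remove-+ b e (suc L + i)) (+-comm _ (eq v (suc L + i))))) ⟩
    le v L + ∑ d (λ i → eq v (suc L + i) + remove v b (suc L + i))
      ≡⟨ cong (le v L +_) (∑-+ d (λ i → eq v (suc L + i)) (λ i → remove v b (suc L + i))) ⟩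
    le v L + (∑ d (λ i → eq v (suc L + i)) + ∑ d (λ i → remove v b (suc L + i)))
      ≡⟨ +-assoc (le v L) _ _ ⟨
    le v L + ∑ d (λ i → eq v (suc L + i)) + ∑ d (λ i → remove v b (suc L + i))
      ≡⟨ cong (_+ ∑ d (λ i → remove v b (suc L + i))) (trans (le-+ d v L) (le-cancel d w L)) ⟩
    le w L + ∑ d (λ i → remove v b (suc L + i)) ∎
    where
    open ≡-Reasoning
    v = w + d

  -- The topmost N-step cannot be reached from v.
  ∏weight-zero : ∀ o K v b → o + K ≤ v → (∀ L → o + K ≤ L → b L ≡ 0) →
    0 < ∑ K (λ i → b (o + i)) → ∏ o K (weight v b) ≈ []
  ∏weight-zero o (suc K) v b oK≤v z s with ∑ K (λ i → b (o + suc i)) in e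
  ... | suc _ = ≈-trans (⊗-cong {weight v b o} ≈-refl
      (∏weight-zero (suc o) K v b (subst (_≤ v) (+-suc o K) oK≤v)
        (λ L l → z L (subst (_≤ L) (sym (+-suc o K)) l))
        (subst (0 <_) (sym (trans (∑-cong K (λ i _ → cong b (sym (+-suc o i)))) e)) z<s)))
      (⊗-zeroʳ (weight v b o))
  ... | zero = subst₂ (λ a c → words a c ⊗ ∏ (suc o) K (weight v b) ≈ []) (sym a≡0) (sym (proj₂ b≡suc)) ≈-refl
    where
    o<v : o < v
    o<v = ≤-trans (m<m+n o z<s) oK≤v
    above : ∀ L → o < L → b L ≡ 0
    above L o<L with L ≤? o + K
    ... | no L≰ = z L (subst (_≤ L) (sym (+-suc o K)) (≰⇒> L≰))
    ... | yes L≤ = trans (cong b (sym (trans (+-suc o _) (m+[n∸m]≡n o<L))))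
        (∑≡0⇒ K e (L ∸ suc o) (subst (_≤ K) (+-∸-assoc 1 {L} {suc o} o<L) (m≤n+o⇒m∸n≤o L o L≤)))
    a≡0 : esteps v b o ≡ 0
    a≡0 = cong₂ _+_ (le-no o<v) (∑-zero d (λ i _ → above (suc o + i) (s≤s (m≤m+n o i))))
    b≡suc : ∃[ B ] b o ≡ suc B
    b≡suc with b o in eo | subst (0 <_) (trans (+-identityʳ _) (cong b (+-identityʳ o))) s
    ... | suc B | _ = B , refl
    ... | zero | ()

  le-suc-off : ∀ {v L} → L ≢ v → le v L ≡ le (suc v) L
  le-suc-off {v} {L} L≢v with <-cmp v L
  ... | tri< v<L _ _ = trans (le-yes (<⇒≤ v<L)) (sym (le-yes v<L))
  ... | tri≈ _ refl _ = ⊥-elim (L≢v refl)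
  ... | tri> _ _ L<v = trans (le-no L<v) (sym (le-no (m<n⇒m<1+n L<v)))

  esteps-here : ∀ v b → esteps v b v ≡ suc (esteps (suc v) b v)
  esteps-here v b = cong₂ _+_ (le-yes {v} ≤-refl) (cong (_+ ∑ d (λ i → b (suc v + i))) (sym (le-no {suc v} {v} ≤-refl)))

  weight-suc-off : ∀ {v L} b → L ≢ v → weight v b L ≈ weight (suc v) b L
  weight-suc-off {v} {L} b L≢v rewrite le-suc-off L≢v = ≈-refl

  -- Only the number of E-steps at `v` drops, and a word without N has weight 1 whatever its length.
  ∏weight-E : ∀ M {v} b → b v ≡ 0 → ∏ 0 M (weight v b) ≈ ∏ 0 M (weight (suc v) b)
  ∏weight-E M {v} b bv = ∏-cong 0 M go
    where
    go : ∀ L → 0 ≤ L → L < M → weight v b L ≈ weight (suc v) b L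
    go L _ _ with L ≟ v
    ... | no L≢v = weight-suc-off b L≢v
    ... | yes refl rewrite bv = ≈-trans (words-zeroʳ (esteps v b v)) (≈-sym (words-zeroʳ (esteps (suc v) b v)))

  -- The first step is E, which pairs with all `b (w + d)` later N-steps of its level, or N, which
  -- uses up one of them. At `w + d` this is `words-rec`; the other factors agree.
  ∏weight-step : ∀ M w {B} b → w + d < M → b (w + d) ≡ suc B →
    ∏ 0 M (weight (w + d) b) ≈
      tpow* (b (w + d)) (∏ 0 M (weight (suc (w + d)) b)) ⊕ ∏ 0 M (weight w (remove (w + d) b))
  ∏weight-step M w {B} b v<M e = ∏-linear 0 M v (b v) z≤n v<M
      (λ L → weight-suc-off b) offN here
    where
    v = w + d
    offN : ∀ L → L ≢ v → weight v b L ≈ weight w (remove v b) L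
    offN L L≢v rewrite esteps-remove w b L e | remove-off b L≢v = ≈-refl
    here : weight v b v ≈ tpow* (b v) (weight (suc v) b v) ⊕ weight w (remove v b) v
    here rewrite sym (esteps-remove w b v e) | esteps-here v b | remove-at v b | e = words-rec (esteps (suc v) b v) B

  hook-E : ∀ x z ν → x < z →
    hook x (z ∷ ν) ≡ levels (z ∷ ν) (d * suc (length ν) + x) + hook (suc x) (z ∷ ν)
  hook-E x z ν x<z = begin
    ∑ (z ∸ x) f + hook z ν               ≡⟨ cong (λ n → ∑ n f + hook z ν) (+-∸-assoc 1 {z} {suc x} x<z) ⟩
    ∑ (suc (z ∸ suc x)) f + hook z ν     ≡⟨ +-assoc (f 0) _ _ ⟩
    f 0 + (∑ (z ∸ suc x) (f ∘ suc) + hook z ν)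
      ≡⟨ cong₂ (λ a s → a + (s + hook z ν)) (cong g (+-identityʳ x)) (∑-cong (z ∸ suc x) (λ i _ → cong g (+-suc x i))) ⟩
    g x + hook (suc x) (z ∷ ν)           ∎
    where
    open ≡-Reasoning
    g f : ℕ → ℕ
    g y = levels (z ∷ ν) (d * suc (length ν) + y)
    f w = g (x + w)

  hook-N : ∀ x ν → hook x (x ∷ ν) ≡ hook x ν
  hook-N x ν rewrite n∸n≡0 x = refl

  -- Sums over paths are compared one coefficient at a time, so a power of t appears as a shift of
  -- the statistic.
  ∑↗-tpow* : ∀ r x c (G : List ℕ → ℕ) (T : List ℕ → ℕ) b p →
    (∀ k → ∑↗ r x c (λ ν → G ν * eq (T ν) k) ≡ coeff k p) →
    ∀ k → ∑↗ r x c (λ ν → G ν * eq (b + T ν) k) ≡ coeff k (tpow* b p)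
  ∑↗-tpow* r x c G T b p e k with b ≤? k
  ... | yes b≤k = subst (λ k → ∑↗ r x c (λ ν → G ν * eq (b + T ν) k) ≡ coeff k (tpow* b p)) (m+[n∸m]≡n b≤k)
      (trans (∑↗-cong r x c (λ ν _ _ → cong (G ν *_) (eq-shift b (T ν) (k ∸ b))))
        (trans (e (k ∸ b)) (sym (coeff-tpow* b (k ∸ b) p))))
  ... | no b≰k = trans (∑↗-zero r x c (λ ν _ _ → trans
        (cong (G ν *_) (eq-no (λ q → b≰k (subst (b ≤_) q (m≤m+n b (T ν)))))) (*-zeroʳ (G ν))))
      (sym (coeff-tpow*-< b k p (≰⇒> b≰k)))

  -- Both sides obey the recursion by the first step: N makes `x` the next row, E moves on to
  -- `suc x`. The level of a row is at least its length, so a cap `x + c` that reaches `M` excludes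
  -- no path with levels `b`, and `c` bounds the number of E-steps in the recursion.
  ∑-paths : ∀ r x c M b → M ≤ x + c → ∑ M b ≡ r → (∀ L → M ≤ L → b L ≡ 0) → ∀ k →
    ∑↗ r x c (λ ν → hasLevels b ν * eq (hook x ν) k) ≡ coeff k (∏ 0 M (weight (d * r + x) b))
  ∑-paths zero x c M b _ s z k = trans (eq0 k) (sym (coeffs (∏-cong-one) k))
    where
    eq0 : ∀ k → eq 0 k + 0 ≡ coeff k one
    eq0 zero = refl
    eq0 (suc k) = refl
    b≡0 : ∀ L → b L ≡ 0
    b≡0 L with M ≤? L
    ... | yes M≤L = z L M≤L
    ... | no M≰L = ∑≡0⇒ M s L (≰⇒> M≰L)
    ∏-cong-one : ∏ 0 M (weight (d * 0 + x) b) ≈ one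
    ∏-cong-one = ∏-one 0 M (λ L _ → subst (λ c → words (esteps (d * 0 + x) b L) c ≈ one) (sym (b≡0 L)) (words-zeroʳ (esteps (d * 0 + x) b L)))
  -- Now `x` has reached `M`, so the next row would have a level where `b` is 0: both sides vanish.
  ∑-paths (suc r) x zero M b M≤ s z k =
    trans (∑↗-zero r x zero (λ ν _ _ → cong (_* eq (hook x (x ∷ ν)) k)
            (hasLevels-∉ b x ν (z _ (≤-trans M≤x (m≤n+m x _))))))
          (sym (coeffs (∏weight-zero 0 M (d * suc r + x) b (≤-trans M≤x (m≤n+m x _)) z (subst (0 <_) (sym s) z<s)) k))
    where
    M≤x : M ≤ x
    M≤x = subst (M ≤_) (+-identityʳ x) M≤
  ∑-paths (suc r) x (suc c) M b M≤ s z k = trans (cong₂ _+_ termN termE) combine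
    where
    v w : ℕ
    v = d * suc r + x
    w = d * r + x
    v≡w+d : v ≡ w + d
    v≡w+d = trans (cong (_+ x) (*-suc d r)) (comm d (d * r) x)
      where
      comm : ∀ a b c → a + b + c ≡ b + c + a
      comm = solve-∀
    PE = ∏ 0 M (weight (suc v) b)
    PN = ∏ 0 M (weight w (remove v b))
    E′ : ∀ ν → length ν ≡ suc r → Chain (suc x) ν →
      hasLevels b ν * eq (hook x ν) k ≡ hasLevels b ν * eq (b v + hook (suc x) ν) k
    -- Where `hasLevels` is not 0, `b v` equals the number of rows of level `v`, all still ahead:
    -- these are the N-steps that the E-step at `v` pairs with.
    E′ (y ∷ ν) l (x<y , _) with hasLevels-sound M b (y ∷ ν) (trans s (sym l)) z
    ... | inj₁ h rewrite h = refl
    ... | inj₂ (_ , f) = cong (λ t → hasLevels b (y ∷ ν) * eq t k)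
          (trans (hook-E x y ν x<y)
            (cong (_+ hook (suc x) (y ∷ ν)) (trans (cong (λ r → levels (y ∷ ν) (d * r + x)) l) (sym (f v)))))
    termE : ∑↗ (suc r) (suc x) c (λ ν → hasLevels b ν * eq (hook x ν) k) ≡ coeff k (tpow* (b v) PE)
    termE = trans (∑↗-cong (suc r) (suc x) c E′)
      (∑↗-tpow* (suc r) (suc x) c (hasLevels b) (hook (suc x)) (b v) PE
        (subst (λ u → ∀ k → ∑↗ (suc r) (suc x) c (λ ν → hasLevels b ν * eq (hook (suc x) ν) k) ≡ coeff k (∏ 0 M (weight u b)))
          (+-suc (d * suc r) x)
          (∑-paths (suc r) (suc x) c M b (subst (M ≤_) (+-suc x c) M≤) s z)) k)
    IHN : ∀ {B} → b v ≡ suc B →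
      ∑↗ r x (suc c) (λ ν → hasLevels (remove v b) ν * eq (hook x ν) k) ≡ coeff k PN
    IHN e = ∑-paths r x (suc c) M (remove v b) M≤
        (∑-remove M b e (≰⇒> (λ M≤v → 0≢1+n (trans (sym (z v M≤v)) e))) s) (remove-bound {v = v} b z) k
    termN : ∑↗ r x (suc c) (λ ν → hasLevels b (x ∷ ν) * eq (hook x (x ∷ ν)) k) ≡ positive (b v) * coeff k PN
    termN with b v in e
    ... | zero = ∑↗-zero r x (suc c) (λ ν l _ →
            cong (_* eq (hook x (x ∷ ν)) k) (hasLevels-∉ b x ν (trans (cong (λ r → b (d * suc r + x)) l) e)))
    ... | suc B = trans (∑↗-cong r x (suc c) go) (trans (IHN e) (sym (+-identityʳ _)))
      where
      go : ∀ ν → length ν ≡ r → Chain x ν →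
        hasLevels b (x ∷ ν) * eq (hook x (x ∷ ν)) k ≡ hasLevels (remove v b) ν * eq (hook x ν) k
      go ν l _ = cong₂ _*_ (hasLevels-∷ b x ν (cong (λ r → d * suc r + x) l) e) (cong (λ t → eq t k) (hook-N x ν))
    combine : positive (b v) * coeff k PN + coeff k (tpow* (b v) PE) ≡ coeff k (∏ 0 M (weight v b))
    combine with b v in e
    ... | zero = sym (coeffs (∏weight-E M b e) k)
    ... | suc B = begin
      coeff k PN + 0 + coeff k (tpow* (suc B) PE)   ≡⟨ trans (cong (_+ coeff k (tpow* (suc B) PE)) (+-identityʳ _)) (+-comm (coeff k PN) _) ⟩
      coeff k (tpow* (suc B) PE) + coeff k PN       ≡⟨ coeff-⊕ k (tpow* (suc B) PE) PN ⟨
      coeff k (tpow* (suc B) PE ⊕ PN)               ≡⟨ cong (λ β → coeff k (tpow* β PE ⊕ PN)) e ⟨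
      coeff k (tpow* (b v) PE ⊕ PN)                 ≡⟨ coeffs step k ⟨
      coeff k (∏ 0 M (weight v b))                  ∎
      where
      open ≡-Reasoning
      v<M : v < M
      v<M = ≰⇒> (λ M≤v → 0≢1+n (trans (sym (z v M≤v)) e))
      step : ∏ 0 M (weight v b) ≈ tpow* (b v) PE ⊕ PN
      step = subst (λ u → ∏ 0 M (weight u b) ≈ tpow* (b u) (∏ 0 M (weight (suc u) b)) ⊕ ∏ 0 M (weight w (remove u b)))
        (sym v≡w+d) (∏weight-step M w b (subst (_< M) v≡w+d v<M) (trans (cong b (sym v≡w+d)) e))

-- Counting cells by diagonals.

rowsum-+ : ∀ f g ν → rowsum (λ i y → f i y + g i y) ν ≡ rowsum f ν + rowsum g ν
rowsum-+ f g [] = refl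
rowsum-+ f g (z ∷ ν) rewrite rowsum-+ f g ν = +-interchange (f (suc (length ν)) z) _ _ _

rowsum-cong : ∀ {f g} → (∀ i y → f (suc i) y ≡ g (suc i) y) → ∀ ν → rowsum f ν ≡ rowsum g ν
rowsum-cong e [] = refl
rowsum-cong e (z ∷ ν) = cong₂ _+_ (e (length ν) z) (rowsum-cong e ν)

rowsum-index : ∀ g ν → rowsum (λ i _ → g i) ν ≡ ∑ (length ν) (g ∘ suc)
rowsum-index g [] = refl
rowsum-index g (z ∷ ν) rewrite rowsum-index g ν =
  trans (+-comm (g (suc (length ν))) _) (sym (∑-snoc (length ν) (g ∘ suc)))

-- For `p = d i` this marks the diagonals d i + 1, ..., d i + y, which the cells of the i-th row
-- meet once each.
interval : ℕ → ℕ → ℕ → ℕ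
interval p y L = le (suc p) L * le L (p + y)

interval-low : ∀ {p L} y → L ≤ p → interval p y L ≡ 0
interval-low {p} {L} y L≤p = cong (_* le L (p + y)) (le-no (s≤s L≤p))

interval-high : ∀ {p y L} → p + y < L → interval p y L ≡ 0
interval-high {p} {y} {L} l = trans (cong (le (suc p) L *_) (le-no l)) (*-zeroʳ (le (suc p) L))

interval-in : ∀ {p y L} → p < L → L ≤ p + y → interval p y L ≡ 1
interval-in l u = cong₂ _*_ (le-yes l) (le-yes u)

interval≤1 : ∀ p y L → interval p y L ≤ 1
interval≤1 p y L with L ≤? p | L ≤? p + y
... | yes l | _ = ≤-trans (≤-reflexive (interval-low y l)) z≤n
... | no _ | no u = ≤-trans (≤-reflexive (interval-high (≰⇒> u))) z≤n
... | no l | yes u = ≤-reflexive (interval-in (≰⇒> l) u)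

-- The indicator changes only at its two ends: it rises just after `p` and falls just after `p + y`.
interval-step : ∀ p y L → interval p y L + eq p L ≡ interval p y (suc L) + eq (p + y) L
interval-step p y L with <-cmp p L | <-cmp (p + y) L
... | tri< p<L p≢L _ | tri< q<L q≢L _
  rewrite interval-high {p} {y} q<L | interval-high {p} {y} (m<n⇒m<1+n q<L) | eq-no p≢L | eq-no q≢L = refl
... | tri< p<L p≢L _ | tri≈ _ refl _
  rewrite interval-in {p} {y} p<L ≤-refl | interval-high {p} {y} (n<1+n (p + y)) | eq-no p≢L | eq-yes {p + y} refl = refl
... | tri< p<L p≢L _ | tri> _ q≢L L<q
  rewrite interval-in {p} {y} p<L (<⇒≤ L<q) | interval-in {p} {y} (m<n⇒m<1+n p<L) L<q | eq-no p≢L | eq-no q≢L = refl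
... | tri≈ _ refl _ | tri< q<L _ _ = ⊥-elim (<⇒≱ q<L (m≤m+n p y))
... | tri≈ _ refl _ | tri≈ _ q≡L _
  rewrite interval-low {p} y ≤-refl | interval-high {p} {y} (s≤s (≤-reflexive q≡L)) | eq-yes q≡L | eq-yes {p} refl = refl
... | tri≈ _ refl _ | tri> _ q≢L L<q
  rewrite interval-low {p} y ≤-refl | interval-in {p} {y} (n<1+n p) L<q | eq-no q≢L | eq-yes {p} refl = refl
... | tri> _ p≢L L<p | _
  rewrite interval-low {p} y (<⇒≤ L<p) | interval-low {p} y L<p | eq-no p≢L
  | eq-no (λ q≡L → <⇒≱ L<p (subst (p ≤_) q≡L (m≤m+n p y))) = refl

∑-interval : ∀ p y K → ∑ (p + (y + K)) (λ L → interval p y (suc L)) ≡ y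
∑-interval p y K = begin
  ∑ (p + (y + K)) f                                   ≡⟨ ∑-split p (y + K) f ⟩
  ∑ p f + ∑ (y + K) (λ L → f (p + L))                 ≡⟨ cong (_+ ∑ (y + K) (λ L → f (p + L))) (∑-zero p (λ L L<p → interval-low y L<p)) ⟩
  ∑ (y + K) (λ L → f (p + L))                         ≡⟨ ∑-extend y K (λ L → interval-high {p} {y} (s≤s (+-monoʳ-≤ p (m≤m+n y L)))) ⟩
  ∑ y (λ L → f (p + L))                               ≡⟨ ∑-cong y (λ L L<y → interval-in (s≤s (m≤m+n p L)) (subst (_≤ p + y) (+-suc p L) (+-monoʳ-≤ p L<y))) ⟩
  ∑ y (λ _ → 1)                                       ≡⟨ trans (∑-const y 1) (*-identityʳ y) ⟩
  y                                                   ∎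
  where
  open ≡-Reasoning
  f = λ L → interval p y (suc L)

module Diagonals (d : ℕ) (0<d : 0 < d) where

  open Paths d

  -- The number of cells on the diagonal d i + c = L, where i, c ≥ 1 are the row and the column.
  diag : List ℕ → ℕ → ℕ
  diag ν L = rowsum (λ i y → interval (d * i) y L) ν

  -- The levels of the empty partition padded to `n` rows. At positive levels up to `d * n` it
  -- agrees with `χ∣ d`.
  multiples : ℕ → ℕ → ℕ
  multiples n L = ∑ n (λ i → eq (d * suc i) L)

  -- From the diagonal `L` to the next one, the rows with d i = L enter and those with d i + y = L
  -- drop out.
  diag-step : ∀ ν L → diag ν L + multiples (length ν) L ≡ diag ν (suc L) + levels ν L
  diag-step ν L = begin
    diag ν L + multiples (length ν) L
      ≡⟨ cong (diag ν L +_) (rowsum-index (λ i → eq (d * i) L) ν) ⟨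
    diag ν L + rowsum (λ i _ → eq (d * i) L) ν
      ≡⟨ rowsum-+ (λ i y → interval (d * i) y L) (λ i _ → eq (d * i) L) ν ⟨
    rowsum (λ i y → interval (d * i) y L + eq (d * i) L) ν
      ≡⟨ rowsum-cong (λ i y → interval-step (d * suc i) y L) ν ⟩
    rowsum (λ i y → interval (d * i) y (suc L) + eq (d * i + y) L) ν
      ≡⟨ rowsum-+ (λ i y → interval (d * i) y (suc L)) (λ i y → eq (d * i + y) L) ν ⟩
    diag ν (suc L) + levels ν L ∎
    where open ≡-Reasoning

  -- The `d` levels after `L` contain exactly one multiple of `d`, and it exceeds `d * n` exactly
  -- when `L` is at least `d * n`. In terms of paths: for the empty partition one E-step leaves each
  -- level.
  multiples-window : ∀ n L → le (d * n) L + ∑ d (λ i → multiples n (suc L + i)) ≡ 1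
  multiples-window zero L = cong₂ _+_ (cong (λ z → le z L) (*-zeroʳ d)) (∑-zero d (λ _ _ → refl))
  multiples-window (suc n) L = begin
    le u L + ∑ d (λ i → multiples (suc n) (suc L + i))
      ≡⟨ cong (le u L +_) (∑-cong d (λ i _ → trans (∑-snoc n (λ j → eq (d * suc j) (suc L + i))) (+-comm _ (eq u (suc L + i))))) ⟩
    le u L + ∑ d (λ i → eq u (suc L + i) + multiples n (suc L + i))
      ≡⟨ cong (le u L +_) (∑-+ d (λ i → eq u (suc L + i)) (λ i → multiples n (suc L + i))) ⟩
    le u L + (∑ d (λ i → eq u (suc L + i)) + ∑ d (λ i → multiples n (suc L + i)))
      ≡⟨ +-assoc (le u L) _ _ ⟨
    le u L + ∑ d (λ i → eq u (suc L + i)) + ∑ d (λ i → multiples n (suc L + i))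
      ≡⟨ cong (_+ ∑ d (λ i → multiples n (suc L + i))) (le-+ d u L) ⟩
    le u (L + d) + ∑ d (λ i → multiples n (suc L + i))
      ≡⟨ cong (λ u → le u (L + d) + ∑ d (λ i → multiples n (suc L + i))) (trans (*-suc d n) (+-comm d (d * n))) ⟩
    le (d * n + d) (L + d) + ∑ d (λ i → multiples n (suc L + i))
      ≡⟨ cong (_+ ∑ d (λ i → multiples n (suc L + i))) (le-cancel d (d * n) L) ⟩
    le (d * n) L + ∑ d (λ i → multiples n (suc L + i))
      ≡⟨ multiples-window n L ⟩
    1 ∎
    where
    open ≡-Reasoning
    u = d * suc n

  -- The balance summed over `d` consecutive levels compares `b` with the empty partition: the
  -- surplus of E-steps over 1 is `g 0` minus `g d`. This difference becomes the lower entry of the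
  -- Gaussian binomial.
  window : ∀ n b L (g : ℕ → ℕ) →
    (∀ i → i < d → g i + multiples n (suc L + i) ≡ g (suc i) + b (suc L + i)) →
    suc (g 0) ≡ g d + esteps (d * n) b L
  window n b L g e = begin
    suc (g 0)
      ≡⟨ +-comm 1 (g 0) ⟩
    g 0 + 1
      ≡⟨ cong (g 0 +_) (trans (sym (multiples-window n L)) (+-comm (le (d * n) L) _)) ⟩
    g 0 + (∑ d (λ i → multiples n (suc L + i)) + le (d * n) L)
      ≡⟨ +-assoc (g 0) _ _ ⟨
    g 0 + ∑ d (λ i → multiples n (suc L + i)) + le (d * n) L
      ≡⟨ cong (_+ le (d * n) L) (telescope d g (λ i → multiples n (suc L + i)) (λ i → b (suc L + i)) e) ⟩
    g d + ∑ d (λ i → b (suc L + i)) + le (d * n) L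
      ≡⟨ +-assoc (g d) _ _ ⟩
    g d + (∑ d (λ i → b (suc L + i)) + le (d * n) L)
      ≡⟨ cong (g d +_) (+-comm _ (le (d * n) L)) ⟩
    g d + esteps (d * n) b L ∎
    where open ≡-Reasoning

  diag-window : ∀ ν L → suc (diag ν (suc L)) ≡ diag ν (suc (L + d)) + esteps (d * length ν) (levels ν) L
  diag-window ν L = trans (cong (suc ∘ diag ν) (sym (+-identityʳ (suc L))))
    (window (length ν) (levels ν) L (λ i → diag ν (suc L + i)) step)
    where
    step : ∀ i → i < d → diag ν (suc L + i) + multiples (length ν) (suc L + i) ≡ diag ν (suc L + suc i) + levels ν (suc L + i)
    step i _ rewrite +-suc L i = diag-step ν (suc L + i)

  -- The path starts above `L`, and an N-step, falling by exactly `d`, can end at `L` or below only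
  -- from one of the levels `L + 1`, ..., `L + d` if it starts above `L`. There is no N-step on
  -- these, so the path stays above `L`.
  levels-esteps : ∀ x ν → Chain x ν → ∀ L → esteps (d * length ν + x) (levels ν) L ≡ 0 → levels ν L ≡ 0
  levels-esteps x [] _ L _ = refl
  levels-esteps x (z ∷ ν) (x≤z , ch) L a≡0 = cong₂ _+_ (eq-no (<⇒≢ L<u ∘ sym))
      (levels-esteps z ν ch L (cong₂ _+_ (le-no L<w) (∑-zero d (λ i i<d → m+n≡0⇒n≡0 (eq u (suc L + i)) (none i i<d)))))
    where
    u w : ℕ
    u = d * suc (length ν) + z
    w = d * length ν + z
    none : ∀ i → i < d → levels (z ∷ ν) (suc L + i) ≡ 0
    none = ∑≡0⇒ d (m+n≡0⇒n≡0 (le (d * suc (length ν) + x) L) a≡0)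
    L<u : L < u
    L<u = ≤-trans (≰⇒> (λ v≤L → 0≢1+n (trans (sym (m+n≡0⇒m≡0 _ a≡0)) (le-yes v≤L)))) (+-monoʳ-≤ (d * suc (length ν)) x≤z)
    u≡ : u ≡ w + d
    u≡ = trans (cong (_+ z) (*-suc d (length ν))) (comm d (d * length ν) z)
      where
      comm : ∀ a b c → a + b + c ≡ b + c + a
      comm = solve-∀
    L<w : L < w
    L<w with suc L ≤? w
    ... | yes p = p
    ... | no p = ⊥-elim (0≢1+n (trans (sym (m+n≡0⇒m≡0 _ (none i i<d))) (eq-yes {u} (sym (m+[n∸m]≡n L<u)))))
      where
      i = u ∸ suc L
      i<d : i < d
      i<d = +-cancelˡ-< (suc L) i d (subst (_< suc L + d) (sym (m+[n∸m]≡n L<u))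
              (subst (_< suc L + d) (sym u≡) (+-monoˡ-< d (≰⇒> p))))

  module _ {v : ℕ} {b : ℕ → ℕ} (N⇒E : ∀ L → esteps v b L ≡ 0 → b L ≡ 0) where

    -- The window above `L` lies in the one above `suc L` except for `suc L` itself, where `N⇒E`
    -- excludes N-steps. So the levels that no E-step leaves form an initial segment.
    esteps-pred : ∀ L → esteps v b (suc L) ≡ 0 → esteps v b L ≡ 0
    esteps-pred L e = cong₂ _+_
      (m+n≡0⇒m≡0 (le v L) (trans (le-suc v L) (m+n≡0⇒m≡0 _ e)))
      (∑-zero d go)
      where
      go : ∀ i → i < d → b (suc L + i) ≡ 0
      go zero _ = trans (cong b (+-identityʳ (suc L))) (N⇒E (suc L) e)
      go (suc i) i<d = trans (cong (b ∘ suc) (+-suc L i)) (∑≡0⇒ d (m+n≡0⇒n≡0 (le v (suc L)) e) i (<-trans (n<1+n i) i<d))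

    esteps-below : ∀ {L′} L → L ≤ L′ → esteps v b L′ ≡ 0 → esteps v b L ≡ 0
    esteps-below L L≤L′ e with m≤n⇒m<n∨m≡n L≤L′
    ... | inj₂ refl = e
    esteps-below {suc L′} L _ e | inj₁ (s≤s L≤L′) = esteps-below L L≤L′ (esteps-pred L′ e)

    first-visited : ∀ k → esteps v b (d * k) ≢ 0 →
      ∃[ r ] (r ≤ k × esteps v b (d * r) ≢ 0 × (∀ r′ → r′ < r → esteps v b (d * r′) ≡ 0))
    first-visited zero e = 0 , z≤n , e , λ _ ()
    first-visited (suc k) e with esteps v b (d * k) in eq
    ... | zero = suc k , ≤-refl , e , λ r′ r′<k → esteps-below (d * r′) (*-monoʳ-≤ d (s≤s⁻¹ r′<k)) eq
    ... | suc _ with first-visited k (λ z → 0≢1+n (trans (sym z) eq))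
    ...   | r , r≤k , p = r , m≤n⇒m≤1+n r≤k , p

  diag-low : ∀ ν L → L < d → diag ν (suc L) ≡ 0
  diag-low [] L _ = refl
  diag-low (z ∷ ν) L L<d = cong₂ _+_
    (interval-low z (≤-trans L<d (m≤m*n d (suc (length ν))))) (diag-low ν L L<d)

  diag≤length : ∀ ν L → diag ν L ≤ length ν
  diag≤length [] L = z≤n
  diag≤length (z ∷ ν) L = +-mono-≤ (interval≤1 (d * suc (length ν)) z L) (diag≤length ν L)

  diag-high : ∀ ν L → d * length ν + sum ν < L → diag ν L ≡ 0
  diag-high [] L _ = refl
  diag-high (z ∷ ν) L l = cong₂ _+_
    (interval-high (≤-<-trans (+-monoʳ-≤ (d * suc (length ν)) (m≤m+n z (sum ν))) l))
    (diag-high ν L (≤-<-trans (+-mono-≤ (*-monoʳ-≤ d (n≤1+n (length ν))) (m≤n+m (sum ν) z)) l))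

  ∑-diag : ∀ ν X → d * length ν + sum ν ≤ X → ∑ X (λ L → diag ν (suc L)) ≡ sum ν
  ∑-diag [] X _ = ∑-zero X (λ _ _ → refl)
  ∑-diag (z ∷ ν) X l = trans (∑-+ X (λ L → interval p z (suc L)) (λ L → diag ν (suc L)))
    (cong₂ _+_
      (subst (λ X → ∑ X (λ L → interval p z (suc L)) ≡ z) (trans (sym (+-assoc p z _)) (m+[n∸m]≡n pz≤X)) (∑-interval p z (X ∸ (p + z))))
      (∑-diag ν X (≤-trans (+-mono-≤ (*-monoʳ-≤ d (n≤1+n (length ν))) (m≤n+m (sum ν) z)) l)))
    where
    p = d * suc (length ν)
    pz≤X : p + z ≤ X
    pz≤X = ≤-trans (+-monoʳ-≤ p (m≤m+n z (sum ν))) l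

  levels-zero : ∀ ν → levels ν 0 ≡ 0
  levels-zero [] = refl
  levels-zero (z ∷ ν) = cong₂ _+_
    (eq-no (λ e → <⇒≢ 0<d (sym (m*n≡0⇒m≡0 d (suc (length ν)) (m+n≡0⇒m≡0 _ e))))) (levels-zero ν)

  -- s₁ is the least r such that the boundary path visits the level d r.
  durfee : ∀ ν → Chain 0 ν → ∃[ s₁ ]
    (diag ν (suc (d * s₁)) ≡ s₁
    × (∀ L → d * s₁ ≤ L → diag ν (suc (L + d)) ≤ diag ν (suc L))
    × (∀ L → L ≤ d * s₁ → levels ν L ≡ 0))
  durfee ν ch = s₁ , full s₁ ≤-refl , shrink , empty
    where
    n = length ν
    a = esteps (d * n) (levels ν)
    N⇒E : ∀ L → a L ≡ 0 → levels ν L ≡ 0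
    N⇒E L e = levels-esteps 0 ν ch L (trans (cong (λ v → esteps v (levels ν) L) (+-identityʳ (d * n))) e)
    start : a (d * n) ≢ 0
    start e = 0≢1+n (trans (sym (m+n≡0⇒m≡0 _ e)) (le-yes {d * n} ≤-refl))
    found = first-visited {d * n} {levels ν} N⇒E n start
    s₁ = proj₁ found
    visited = proj₁ (proj₂ (proj₂ found))
    unvisited = proj₂ (proj₂ (proj₂ found))
    -- For `r` below `s₁` no E-step leaves `d * r`, so `diag-window` adds exactly one cell from one
    -- multiple of `d` to the next.
    full : ∀ r → r ≤ s₁ → diag ν (suc (d * r)) ≡ r
    full zero _ = trans (cong (diag ν ∘ suc) (*-zeroʳ d)) (diag-low ν 0 0<d)
    full (suc r) r<s₁ = begin
      diag ν (suc (d * suc r))          ≡⟨ cong (diag ν ∘ suc) (trans (*-suc d r) (+-comm d (d * r))) ⟩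
      diag ν (suc (d * r + d))          ≡⟨ +-identityʳ _ ⟨
      diag ν (suc (d * r + d)) + 0      ≡⟨ cong (diag ν (suc (d * r + d)) +_) (unvisited r r<s₁) ⟨
      diag ν (suc (d * r + d)) + a (d * r) ≡⟨ diag-window ν (d * r) ⟨
      suc (diag ν (suc (d * r)))        ≡⟨ cong suc (full r (<⇒≤ r<s₁)) ⟩
      suc r                             ∎
      where open ≡-Reasoning
    shrink : ∀ L → d * s₁ ≤ L → diag ν (suc (L + d)) ≤ diag ν (suc L)
    shrink L l with a L in e
    ... | zero = ⊥-elim (visited (esteps-below {d * n} {levels ν} N⇒E (d * s₁) l e))
    ... | suc A = s≤s⁻¹ (subst (suc (diag ν (suc (L + d))) ≤_)
        (sym (trans (diag-window ν L) (trans (cong (diag ν (suc (L + d)) +_) e) (+-suc _ A)))) (s≤s (m≤m+n _ A)))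
    -- The windows above the unvisited levels `d * r` contain no N-step, and they tile the levels
    -- from 1 to `d * s₁`.
    below : ∀ r → r ≤ s₁ → ∀ L → L ≤ d * r → levels ν L ≡ 0
    below zero _ L l = trans (cong (levels ν) (n≤0⇒n≡0 (subst (L ≤_) (*-zeroʳ d) l))) (levels-zero ν)
    below (suc r) r<s₁ L l with L ≤? d * r
    ... | yes p = below r (<⇒≤ r<s₁) L p
    ... | no p = trans (cong (levels ν) (sym (m+[n∸m]≡n dr<L)))
        (∑≡0⇒ d (m+n≡0⇒n≡0 (le (d * n) (d * r)) (unvisited r r<s₁)) (L ∸ suc (d * r)) i<d)
      where
      dr<L = ≰⇒> p
      i<d : L ∸ suc (d * r) < d
      i<d = +-cancelˡ-< (suc (d * r)) _ d (subst (_< suc (d * r) + d) (sym (m+[n∸m]≡n dr<L))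
        (s≤s (subst (L ≤_) (trans (*-suc d r) (+-comm d (d * r))) l)))
    empty : ∀ L → L ≤ d * s₁ → levels ν L ≡ 0
    empty = below s₁ ≤-refl

  -- Without N-steps there are no E-steps on these levels, so each diagonal has one cell more than
  -- the one `d` before it. The successive blocks of `d` diagonals have 0, 1, ..., r - 1 cells on
  -- each diagonal.
  ∑-diag-full : ∀ ν s₁ → s₁ ≤ length ν → (∀ L → L ≤ d * s₁ → levels ν L ≡ 0) →
    ∀ r → r ≤ s₁ → ∑ (d * r) (λ L → diag ν (suc L)) ≡ d * (r C 2)
  ∑-diag-full ν s₁ s₁≤n z zero _ = trans (cong (λ X → ∑ X (λ L → diag ν (suc L))) (*-zeroʳ d)) (sym (*-zeroʳ d))
  ∑-diag-full ν s₁ s₁≤n z (suc r) r<s₁ = begin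
    ∑ (d * suc r) f                                  ≡⟨ cong (λ X → ∑ X f) (*-suc d r) ⟩
    ∑ (d + d * r) f                                  ≡⟨ ∑-split d (d * r) f ⟩
    ∑ d f + ∑ (d * r) (λ L → f (d + L))              ≡⟨ cong₂ _+_ (∑-zero d (diag-low ν)) (∑-cong (d * r) shift) ⟩
    ∑ (d * r) (λ L → f L + 1)                        ≡⟨ ∑-+ (d * r) f (λ _ → 1) ⟩
    ∑ (d * r) f + ∑ (d * r) (λ _ → 1)                ≡⟨ cong₂ _+_ (∑-diag-full ν s₁ s₁≤n z r (<⇒≤ r<s₁)) (trans (∑-const (d * r) 1) (*-identityʳ (d * r))) ⟩
    d * (r C 2) + d * r                              ≡⟨ *-distribˡ-+ d (r C 2) r ⟨
    d * (r C 2 + r)                                  ≡⟨ cong (d *_) (trans (+-comm (r C 2) r) (cong (_+ r C 2) (sym (nC1≡n r)))) ⟩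
    d * (r C 1 + r C 2)                              ≡⟨ cong (d *_) (nCk+nC[k+1]≡[n+1]C[k+1] r 1) ⟩
    d * (suc r C 2)                                  ∎
    where
    open ≡-Reasoning
    n = length ν
    f = λ L → diag ν (suc L)
    shift : ∀ L → L < d * r → f (d + L) ≡ f L + 1
    shift L L<dr = begin
      f (d + L)                                      ≡⟨ cong f (+-comm d L) ⟩
      f (L + d)                                      ≡⟨ +-identityʳ _ ⟨
      f (L + d) + 0                                  ≡⟨ cong (f (L + d) +_) a≡0 ⟨
      f (L + d) + esteps (d * n) (levels ν) L        ≡⟨ diag-window ν L ⟨
      suc (f L)                                      ≡⟨ +-comm 1 (f L) ⟩
      f L + 1                                        ∎
      where
      a≡0 : esteps (d * n) (levels ν) L ≡ 0
      a≡0 = cong₂ _+_ (le-no (<-≤-trans L<dr (*-monoʳ-≤ d (≤-trans (<⇒≤ r<s₁) s₁≤n))))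
        (∑-zero d (λ i i<d → z (suc L + i)
          (≤-trans (+-mono-≤ L<dr (<⇒≤ i<d)) (subst (_≤ d * s₁) (trans (*-suc d r) (+-comm d (d * r))) (*-monoʳ-≤ d r<s₁)))))

-- The sequences in S_m and the levels that belong to them.

≡true⇒T : ∀ {b} → b ≡ true → T b
≡true⇒T = Equivalence.from T-≡

T⇒≡true : ∀ {b} → T b → b ≡ true
T⇒≡true = Equivalence.to T-≡

∧-true : ∀ {a b} → a ∧ b ≡ true → a ≡ true × b ≡ true
∧-true {true} e = refl , e

all-range1-sound : ∀ (p : ℕ → Bool) g N → foldr (λ i b → p i ∧ b) true (map suc (applyUpTo g N)) ≡ true →
  ∀ i → i < N → p (suc (g i)) ≡ true
all-range1-sound p g (suc N) e zero _ = proj₁ (∧-true e)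
all-range1-sound p g (suc N) e (suc i) (s≤s i<N) = all-range1-sound p (g ∘ suc) N (proj₂ (∧-true {p (suc (g 0))} e)) i i<N

all-range1-complete : ∀ (p : ℕ → Bool) g N → (∀ i → p (suc (g i)) ≡ true) →
  foldr (λ i b → p i ∧ b) true (map suc (applyUpTo g N)) ≡ true
all-range1-complete p g zero e = refl
all-range1-complete p g (suc N) e = cong₂ _∧_ (e 0) (all-range1-complete p (g ∘ suc) N (e ∘ suc))

at-beyond : ∀ s j → length s ≤ j → at s (suc j) ≡ 0
at-beyond [] j _ = refl
at-beyond (x ∷ s) (suc j) (s≤s l) = at-beyond s j l

at-applyUpTo : ∀ f N j → j < N → at (applyUpTo f N) (suc j) ≡ f j
at-applyUpTo f (suc N) zero _ = refl
at-applyUpTo f (suc N) (suc j) (s≤s j<N) = at-applyUpTo (f ∘ suc) N j j<N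

at-ext : ∀ s s′ → length s ≡ length s′ → (∀ j → at s (suc j) ≡ at s′ (suc j)) → s ≡ s′
at-ext [] [] _ _ = refl
at-ext (x ∷ s) (x′ ∷ s′) l e = cong₂ _∷_ (e 0) (at-ext s s′ (suc-injective l) (e ∘ suc))

∑-at : ∀ s K → ∑ (length s + K) (λ j → at s (suc j)) ≡ sum s
∑-at [] K = ∑-zero K (λ _ _ → refl)
∑-at (x ∷ s) K = cong (x +_) (∑-at s K)

∑-mono-bound : ∀ {m n} f → m ≤ n → ∑ m f ≤ ∑ n f
∑-mono-bound {m} {n} f m≤n = subst (λ n → ∑ m f ≤ ∑ n f) (m+[n∸m]≡n m≤n)
  (subst (∑ m f ≤_) (sym (∑-split m (n ∸ m) f)) (m≤m+n _ _))

foldr-range1 : ∀ (F W : ℕ → Poly) g o N → (∀ i → F (suc (g i)) ≈ W (o + i)) →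
  foldr (λ j p → F j ⊗ p) one (map suc (applyUpTo g N)) ≈ ∏ o N W
foldr-range1 F W g o zero e = ≈-refl
foldr-range1 F W g o (suc N) e = ⊗-cong (subst (λ c → F (suc (g 0)) ≈ W c) (+-identityʳ o) (e 0))
  (foldr-range1 F W (g ∘ suc) (suc o) N (λ i → subst (λ c → F (suc (g (suc i))) ≈ W c) (+-suc o i) (e (suc i))))

-- With `A` free E-steps and `B` N-steps, this identifies a factor with integer entries with
-- `words (suc A) B`.
gauss-ℕ : ∀ p χ q u A B → u ≡ A + q → p + χ ≡ A + q + B →
  gauss (pos p -ℤ pos q +ℤ pos χ) (pos u -ℤ pos q) ≡ gaussℕ (A + B) A
gauss-ℕ p χ q u A B u≡ p+χ≡ = cong₂ gauss top bottom
  where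
  open ≡-Reasoning
  cancel : ∀ x → pos (x + q) -ℤ pos q ≡ pos x
  cancel x = trans (cong (_-ℤ pos q) (ℤₚ.pos-+ x q))
    (trans (ℤₚ.+-assoc (pos x) (pos q) (-ℤ pos q))
      (trans (cong (pos x +ℤ_) (ℤₚ.+-inverseʳ (pos q))) (ℤₚ.+-identityʳ (pos x))))
  swap : ∀ A q B → A + q + B ≡ A + B + q
  swap = solve-∀
  top : pos p -ℤ pos q +ℤ pos χ ≡ pos (A + B)
  top = begin
    pos p +ℤ (-ℤ pos q) +ℤ pos χ      ≡⟨ ℤₚ.+-assoc (pos p) (-ℤ pos q) (pos χ) ⟩
    pos p +ℤ ((-ℤ pos q) +ℤ pos χ)    ≡⟨ cong (pos p +ℤ_) (ℤₚ.+-comm (-ℤ pos q) (pos χ)) ⟩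
    pos p +ℤ (pos χ +ℤ (-ℤ pos q))    ≡⟨ ℤₚ.+-assoc (pos p) (pos χ) (-ℤ pos q) ⟨
    pos p +ℤ pos χ +ℤ (-ℤ pos q)      ≡⟨ cong (_-ℤ pos q) (trans (sym (ℤₚ.pos-+ p χ)) (cong pos (trans p+χ≡ (swap A q B)))) ⟩
    pos (A + B + q) -ℤ pos q          ≡⟨ cancel (A + B) ⟩
    pos (A + B)                       ∎
  bottom : pos u -ℤ pos q ≡ pos A
  bottom = trans (cong (λ z → pos z -ℤ pos q) u≡) (cancel A)

module Sequences (e : ℕ) where

  d m : ℕ
  d = suc e
  m = suc d

  open Paths d
  open Diagonals d z<s

  record InS (s : List ℕ) : Set where
    field
      step : ∀ j → at s (2 + j) ≤ at s (suc j) + χ∣ d (suc j)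
      shrink : ∀ j → at s (suc (j + d)) ≤ at s (suc j)
  open InS

  inS-sound : ∀ s → inS m s ≡ true → InS s
  inS-sound s h = record { step = st ; shrink = sh }
    where
    cond : ∀ j → j < length s → condS m s (suc j) ≡ true
    cond = all-range1-sound (condS m s) id (length s) h
    st : ∀ j → at s (2 + j) ≤ at s (suc j) + χ∣ d (suc j)
    st j with length s ≤? j
    ... | yes l = subst (_≤ at s (suc j) + χ∣ d (suc j)) (sym (at-beyond s (suc j) (m≤n⇒m≤1+n l))) z≤n
    ... | no l = ≤ᵇ⇒≤ _ _ (≡true⇒T (proj₁ (∧-true (cond j (≰⇒> l)))))
    sh : ∀ j → at s (suc (j + d)) ≤ at s (suc j)
    sh j with length s ≤? j
    ... | yes l = subst (_≤ at s (suc j)) (sym (at-beyond s (j + d) (≤-trans l (m≤m+n j d)))) z≤n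
    ... | no l = ≤ᵇ⇒≤ _ _ (≡true⇒T (proj₂ (∧-true {at s (2 + j) ≤ᵇ at s (suc j) + χ∣ d (suc j)} (cond j (≰⇒> l)))))

  inS-complete : ∀ s → InS s → inS m s ≡ true
  inS-complete s r = all-range1-complete (condS m s) id (length s)
    (λ j → cong₂ _∧_ (T⇒≡true (≤⇒≤ᵇ (step r j))) (T⇒≡true (≤⇒≤ᵇ (shrink r j))))

  multiples-high : ∀ n L → d * n < L → multiples n L ≡ 0
  multiples-high n L l = ∑-zero n (λ i i<n → eq-no (<⇒≢ (≤-<-trans (*-monoʳ-≤ d i<n) l)))

  multiples-χ : ∀ n r j → d * r + suc j ≤ d * n → multiples n (suc (d * r) + j) ≡ χ∣ d (suc j)
  multiples-χ n r j l with d ∣? suc j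
  ... | no ∤ = ∑-zero n (λ i _ → eq-no (λ p → ∤ (∣m+n∣m⇒∣n
          (subst (d ∣_) (trans p (sym (+-suc (d * r) j))) (m∣m*n (suc i))) (m∣m*n r))))
  ... | yes (divides (suc q) p) = trans (∑-single n (r + q) i<n (λ i _ i≢ → eq-no (λ p′ →
          i≢ (suc-injective (*-cancelˡ-≡ (suc i) (suc (r + q)) d (trans p′ (sym L≡))))))) (eq-yes L≡)
    where
    L≡ : d * suc (r + q) ≡ suc (d * r) + j
    L≡ = begin
      d * suc (r + q)        ≡⟨ cong (d *_) (+-suc r q) ⟨
      d * (r + suc q)        ≡⟨ *-distribˡ-+ d r (suc q) ⟩
      d * r + d * suc q      ≡⟨ cong (d * r +_) (trans (*-comm d (suc q)) (sym p)) ⟩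
      d * r + suc j          ≡⟨ +-suc (d * r) j ⟩
      suc (d * r) + j        ∎
      where open ≡-Reasoning
    i<n : r + q < n
    i<n = *-cancelˡ-≤ d (subst (_≤ d * n) (trans (+-suc (d * r) j) (sym L≡)) l)

  ∑-multiples : ∀ n r → r ≤ n → ∑ (suc (d * r)) (multiples n) ≡ r
  ∑-multiples n zero _ rewrite *-zeroʳ e = trans (+-identityʳ _) (∑-zero n (λ i _ → refl))
  ∑-multiples n (suc r) r<n = begin
    ∑ (suc (d * suc r)) (multiples n)
      ≡⟨ cong (λ X → ∑ (suc X) (multiples n)) (trans (*-suc d r) (+-comm d (d * r))) ⟩
    ∑ (suc (d * r) + d) (multiples n)
      ≡⟨ ∑-split (suc (d * r)) d (multiples n) ⟩
    ∑ (suc (d * r)) (multiples n) + ∑ d (λ i → multiples n (suc (d * r) + i))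
      ≡⟨ cong₂ _+_ (∑-multiples n r (<⇒≤ r<n))
           (trans (cong (_+ ∑ d (λ i → multiples n (suc (d * r) + i))) (sym (le-no (*-monoʳ-< d r<n)))) (multiples-window n (d * r))) ⟩
    r + 1
      ≡⟨ +-comm r 1 ⟩
    suc r ∎
    where open ≡-Reasoning

  -- By `shrink`, a positive entry forces positive entries `d`, 2 `d`, ... places before it, and
  -- each adds at least 1 to the sum. The argument `f` is fuel for the descent by `d`.
  support : ∀ s → InS s → ∀ f j → j ≤ f → 0 < at s (suc j) → d * at s 1 + j ≤ d * ∑ (suc j) (λ i → at s (suc i))
  support s r f zero _ _ = ≤-reflexive (trans (+-identityʳ _) (cong (d *_) (sym (+-identityʳ _))))
  support s r (suc f) (suc j) (s≤s j≤f) 0<σ with suc j ≤? d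
  ... | yes l = begin
      d * σ 0 + suc j                        ≤⟨ +-mono-≤ (*-monoʳ-≤ d (m≤m+n (σ 0) _)) (≤-trans l (m≤m*n d (σ (suc j)) {{>-nonZero 0<σ}})) ⟩
      d * ∑ (suc j) σ + d * σ (suc j)        ≡⟨ *-distribˡ-+ d (∑ (suc j) σ) (σ (suc j)) ⟨
      d * (∑ (suc j) σ + σ (suc j))          ≡⟨ cong (d *_) (∑-snoc (suc j) σ) ⟨
      d * ∑ (2 + j) σ                        ∎
    where
    open ≤-Reasoning
    σ = λ i → at s (suc i)
  ... | no l = begin
      d * σ 0 + suc j                        ≡⟨ cong (d * σ 0 +_) j≡ ⟩
      d * σ 0 + (j′ + d)                     ≡⟨ +-assoc (d * σ 0) j′ d ⟨
      d * σ 0 + j′ + d                       ≤⟨ +-mono-≤ IH (m≤m*n d (σ (suc j)) {{>-nonZero 0<σ}}) ⟩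
      d * ∑ (suc j′) σ + d * σ (suc j)       ≤⟨ +-monoˡ-≤ (d * σ (suc j)) (*-monoʳ-≤ d (∑-mono-bound σ j′<)) ⟩
      d * ∑ (suc j) σ + d * σ (suc j)        ≡⟨ *-distribˡ-+ d (∑ (suc j) σ) (σ (suc j)) ⟨
      d * (∑ (suc j) σ + σ (suc j))          ≡⟨ cong (d *_) (∑-snoc (suc j) σ) ⟨
      d * ∑ (2 + j) σ                        ∎
    where
    open ≤-Reasoning
    σ = λ i → at s (suc i)
    j′ = j ∸ e
    e≤j : e ≤ j
    e≤j = s≤s⁻¹ (<⇒≤ (≰⇒> l))
    j≡ : suc j ≡ j′ + d
    j≡ = sym (trans (+-suc j′ e) (cong suc (m∸n+n≡m e≤j)))
    j′< : suc j′ ≤ suc j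
    j′< = s≤s (m∸n≤m j e)
    IH : d * σ 0 + j′ ≤ d * ∑ (suc j′) σ
    IH = support s r f j′ (≤-trans (m∸n≤m j e) j≤f)
      (<-≤-trans (subst (λ i → 0 < at s (suc i)) j≡ 0<σ) (shrink r j′))

  ∑-at≤sum : ∀ s j → ∑ j (λ i → at s (suc i)) ≤ sum s
  ∑-at≤sum s j = ≤-trans (∑-mono-bound (λ i → at s (suc i)) (m≤n+m j (length s))) (≤-reflexive (∑-at s j))

  -- The multiset of levels of the rows of the partitions of n, with n rows, that belong to s:
  -- s_{j+1} is the number of their cells on the diagonal d s₁ + 1 + j.
  levelsOf : ℕ → List ℕ → ℕ → ℕ
  levelsOf n s L = if L ≤ᵇ d * at s 1 then 0 else (at s (suc j) + multiples n L) ∸ at s (2 + j)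
    where j = L ∸ suc (d * at s 1)

  levelsOf-low : ∀ n s L → L ≤ d * at s 1 → levelsOf n s L ≡ 0
  levelsOf-low n s L l with L ≤ᵇ d * at s 1 | ≤⇒≤ᵇ l
  ... | true | _ = refl

  levelsOf-high : ∀ n s j → levelsOf n s (suc (d * at s 1) + j) ≡
    (at s (suc j) + multiples n (suc (d * at s 1) + j)) ∸ at s (2 + j)
  levelsOf-high n s j with suc (d * at s 1) + j ≤ᵇ d * at s 1 in eq
  ... | true = ⊥-elim (<⇒≱ (s≤s (m≤m+n (d * at s 1) j)) (≤ᵇ⇒≤ _ _ (≡true⇒T eq)))
  ... | false rewrite m+n∸m≡n (d * at s 1) j = refl

  -- The product for one sequence as a sum over paths.

  module Admissible (s : List ℕ) (r : InS s) {n : ℕ} (q : qexp m s ≡ n) where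

    N s₁ o : ℕ
    N = length s
    s₁ = at s 1
    o = suc (d * s₁)

    σ b : ℕ → ℕ
    σ j = at s (suc j)
    b = levelsOf n s

    sum≤n : sum s ≤ n
    sum≤n = subst (sum s ≤_) q (m≤n+m (sum s) (d * (s₁ C 2)))

    s₁≤n : s₁ ≤ n
    s₁≤n = ≤-trans (subst (_≤ sum s) (+-identityʳ s₁) (∑-at≤sum s 1)) sum≤n

    -- Past level `d * n` the function `multiples n` is 0 while `χ∣ d` is not. Since the entries
    -- vanish there, the balance and the Gaussian factors survive this discrepancy.
    σ-zero : ∀ j → d * n < d * s₁ + j → σ j ≡ 0
    σ-zero j l with σ j in eqσ
    ... | zero = refl
    ... | suc x = ⊥-elim (<⇒≱ l (≤-trans (support s r j j ≤-refl (subst (0 <_) (sym eqσ) z<s))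
            (*-monoʳ-≤ d (≤-trans (∑-at≤sum s (suc j)) sum≤n))))

    -- The condition `step` makes the truncated subtraction in `levelsOf` exact; the outcome is the
    -- counterpart of `diag-step`.
    σ-balance : ∀ j → σ j + multiples n (o + j) ≡ σ (suc j) + b (o + j)
    σ-balance j = sym (trans (cong (σ (suc j) +_) (levelsOf-high n s j)) (m+[n∸m]≡n bound))
      where
      bound : σ (suc j) ≤ σ j + multiples n (o + j)
      bound with d * s₁ + suc j ≤? d * n
      ... | yes l = subst (λ c → σ (suc j) ≤ σ j + c) (sym (multiples-χ n s₁ j l)) (step r j)
      ... | no l = subst (_≤ σ j + multiples n (o + j)) (sym (σ-zero (suc j) (≰⇒> l))) z≤n

    -- From level `M` on, both the list `s` and `multiples n` have run out, so `b` is 0.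
    M K : ℕ
    M = suc (d * n + N)
    K = d * n + N ∸ d * s₁

    M≡ : o + K ≡ M
    M≡ = cong suc (m+[n∸m]≡n (≤-trans (*-monoʳ-≤ d s₁≤n) (m≤m+n (d * n) N)))

    N≤K : N ≤ K
    N≤K = +-cancelˡ-≤ o N K (subst (o + N ≤_) (sym M≡) (s≤s (+-monoˡ-≤ N (*-monoʳ-≤ d s₁≤n))))

    b-bound : ∀ L → M ≤ L → b L ≡ 0
    b-bound L M≤L = subst (λ L → b L ≡ 0) o+j≡L (trans (levelsOf-high n s j) (trans (cong (_∸ σ (suc j)) zero-sum) (0∸n≡0 (σ (suc j)))))
      where
      o≤M : o ≤ M
      o≤M = subst (o ≤_) M≡ (m≤m+n o K)
      j = L ∸ o
      o+j≡L : o + j ≡ L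
      o+j≡L = m+[n∸m]≡n (≤-trans o≤M M≤L)
      zero-sum : σ j + multiples n (o + j) ≡ 0
      zero-sum = cong₂ _+_
        (at-beyond s j (+-cancelˡ-≤ o N j (≤-trans (+-monoʳ-≤ o N≤K) (≤-trans (≤-reflexive M≡) (subst (M ≤_) (sym o+j≡L) M≤L)))))
        (multiples-high n (o + j) (subst (d * n <_) (sym o+j≡L) (<-≤-trans (s≤s (m≤m+n (d * n) N)) M≤L)))

    -- The balance is summed from `o` on. The range misses the multiples of `d` up to `d * s₁`;
    -- there are `s₁` of them, which is exactly the initial value `σ 0`.
    ∑b≡n : ∑ M b ≡ n
    ∑b≡n = begin
      ∑ M b                                                      ≡⟨ cong (λ X → ∑ X b) M≡ ⟨
      ∑ (o + K) b                                                ≡⟨ ∑-split o K b ⟩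
      ∑ o b + ∑ K (λ i → b (o + i))                              ≡⟨ cong (_+ ∑ K (λ i → b (o + i))) (∑-zero o (λ L l → levelsOf-low n s L (s≤s⁻¹ l))) ⟩
      ∑ K (λ i → b (o + i))                                      ≡⟨ cong (_+ ∑ K (λ i → b (o + i))) (at-beyond s K N≤K) ⟨
      σ K + ∑ K (λ i → b (o + i))                                ≡⟨ telescope K σ (λ i → multiples n (o + i)) (λ i → b (o + i)) (λ i _ → σ-balance i) ⟨
      s₁ + ∑ K (λ i → multiples n (o + i))                       ≡⟨ cong (_+ ∑ K (λ i → multiples n (o + i))) (∑-multiples n s₁ s₁≤n) ⟨
      ∑ o (multiples n) + ∑ K (λ i → multiples n (o + i))        ≡⟨ ∑-split o K (multiples n) ⟨
      ∑ (o + K) (multiples n)                                    ≡⟨ cong (λ X → ∑ X (multiples n)) M≡ ⟩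
      ∑ (suc (d * n) + N) (multiples n)                          ≡⟨ ∑-extend (suc (d * n)) N {multiples n} (λ i → multiples-high n (suc (d * n) + i) (s≤s (m≤m+n (d * n) i))) ⟩
      ∑ (suc (d * n)) (multiples n)                              ≡⟨ ∑-multiples n n ≤-refl ⟩
      n                                                          ∎
      where open ≡-Reasoning

    A : ℕ → ℕ
    A j = σ (suc j) ∸ σ (suc j + d)

    esteps≡ : ∀ j → esteps (d * n) b (o + j) ≡ suc (A j)
    esteps≡ j = +-cancelˡ-≡ (σ (suc j + d)) _ _ (begin
      σ (suc j + d) + esteps (d * n) b (o + j)     ≡⟨ window n b (o + j) (λ i → σ (suc j + i)) balance ⟨
      suc (σ (suc j + 0))                          ≡⟨ cong (suc ∘ σ) (+-identityʳ (suc j)) ⟩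
      suc (σ (suc j))                              ≡⟨ cong suc (m+[n∸m]≡n (shrink r (suc j))) ⟨
      suc (σ (suc j + d) + A j)                    ≡⟨ +-suc (σ (suc j + d)) (A j) ⟨
      σ (suc j + d) + suc (A j)                    ∎)
      where
      open ≡-Reasoning
      index : ∀ i → o + suc (j + i) ≡ suc (o + j + i)
      index i = trans (+-suc o (j + i)) (cong suc (sym (+-assoc o j i)))
      balance : ∀ i → i < d → σ (suc j + i) + multiples n (suc (o + j) + i) ≡ σ (suc j + suc i) + b (suc (o + j) + i)
      balance i _ = subst (λ L → σ (suc j + i) + multiples n L ≡ σ (suc j + suc i) + b L) (index i)
        (trans (σ-balance (suc j + i)) (cong (λ x → σ x + b (o + (suc j + i))) (sym (+-suc (suc j) i))))

    factor≈ : ∀ j → factor m s (suc j) ≈ weight (d * n) b (o + j)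
    factor≈ j with d * s₁ + suc j ≤? d * n
    ... | yes l rewrite esteps≡ j | +-suc j d = coeffwise λ k → cong (coeff k)
        (gauss-ℕ (σ j) (χ∣ d (suc j)) (σ (suc j + d)) (σ (suc j)) (A j) (b (o + j))
          (sym A+q) (trans (cong (σ j +_) (sym (multiples-χ n s₁ j l))) (trans (σ-balance j) (cong (_+ b (o + j)) (sym A+q)))))
      where
      A+q : A j + σ (suc j + d) ≡ σ (suc j)
      A+q = m∸n+n≡m (shrink r (suc j))
    -- Here both lower entries are 0, so both Gaussian binomials are 1 even where their upper
    -- entries differ.
    ... | no l = vanishing (σ-zero (suc j) (≰⇒> l))
        (n≤0⇒n≡0 (subst (σ (suc j + d) ≤_) (σ-zero (suc j) (≰⇒> l)) (shrink r (suc j))))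
      where
      vanishing : σ (suc j) ≡ 0 → σ (suc j + d) ≡ 0 → factor m s (suc j) ≈ weight (d * n) b (o + j)
      vanishing u≡0 q≡0 rewrite esteps≡ j | +-suc j d | u≡0 | q≡0 = coeffwise λ k → cong (coeff k)
        (trans (gauss-ℕ (σ j) (χ∣ d (suc j)) 0 0 0 (σ j + χ∣ d (suc j)) refl refl)
          (trans (gaussℕ-zeroʳ (σ j + χ∣ d (suc j))) (sym (gaussℕ-zeroʳ (b (o + j))))))

    -- Levels below `o` have no N-step, and levels from `o + N` on have a single E-step, which must
    -- come last: either way only one word is possible.
    prodFactors≈ : prodFactors m s ≈ ∏ 0 M (weight (d * n) b)
    prodFactors≈ = begin
      prodFactors m s                      ≈⟨ foldr-range1 (factor m s) W id o N factor≈ ⟩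
      ∏ o N W                              ≈⟨ ∏-dropʳ o N (K ∸ N) tail ⟨
      ∏ o (N + (K ∸ N)) W                  ≡⟨ cong (λ X → ∏ o X W) (m+[n∸m]≡n N≤K) ⟩
      ∏ o K W                              ≈⟨ ∏-dropˡ 0 o K head ⟨
      ∏ 0 (o + K) W                        ≡⟨ cong (λ X → ∏ 0 X W) M≡ ⟩
      ∏ 0 M W                              ∎
      where
      open ≈-Reasoning
      W = weight (d * n) b
      head : ∀ L → L < o → W L ≈ one
      head L l = subst (λ c → words (esteps (d * n) b L) c ≈ one) (sym (levelsOf-low n s L (s≤s⁻¹ l))) (words-zeroʳ (esteps (d * n) b L))
      tail : ∀ L → o + N ≤ L → W L ≈ one
      tail L l = subst (λ L → W L ≈ one) (m+[n∸m]≡n (≤-trans (m≤m+n o N) l)) go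
        where
        j = L ∸ o
        N≤j : N ≤ j
        N≤j = +-cancelˡ-≤ o N j (subst (o + N ≤_) (sym (m+[n∸m]≡n (≤-trans (m≤m+n o N) l))) l)
        A≡0 : A j ≡ 0
        A≡0 = trans (cong (_∸ σ (suc j + d)) (at-beyond s (suc j) (m≤n⇒m≤1+n N≤j))) (0∸n≡0 (σ (suc j + d)))
        go : W (o + j) ≈ one
        go rewrite esteps≡ j | A≡0 | gaussℕ-zeroʳ (b (o + j)) = ≈-refl

    coeff-prodFactors : ∀ k →
      coeff k (prodFactors m s) ≡ ∑↗ n 0 M (λ ν → hasLevels b ν * eq (hook 0 ν) k)
    coeff-prodFactors k = trans (coeffs prodFactors≈ k)
      (trans (cong (λ v → coeff k (∏ 0 M (weight v b))) (sym (+-identityʳ (d * n))))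
        (sym (∑-paths n 0 M M b ≤-refl ∑b≡n b-bound k)))

-- The correspondence between partitions and sequences.

module Matching (e : ℕ) where

  open Sequences e
  open InS
  open Paths d
  open Diagonals d z<s

  admissible : ℕ → List ℕ → Bool
  admissible n s = inS m s ∧ (qexp m s ≡ᵇ n)

  Matches : List ℕ → List ℕ → Set
  Matches s ν = ∀ j → at s (suc j) ≡ diag ν (suc (d * at s 1) + j)

  qexp-matching : ∀ s ν → Matches s ν → (∀ L → L ≤ d * at s 1 → levels ν L ≡ 0) → qexp m s ≡ sum ν
  qexp-matching s ν match low = begin
    d * (s₁ C 2) + sum s
      ≡⟨ cong₂ _+_ (∑-diag-full ν s₁ s₁≤n low s₁ ≤-refl) (trans (∑-cong (length s + X) (λ j _ → sym (match j))) (∑-at s X)) ⟨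
    ∑ (d * s₁) (λ L → diag ν (suc L)) + ∑ (length s + X) (λ j → diag ν (suc (d * s₁) + j))
      ≡⟨ ∑-split (d * s₁) (length s + X) (λ L → diag ν (suc L)) ⟨
    ∑ (d * s₁ + (length s + X)) (λ L → diag ν (suc L))
      ≡⟨ ∑-diag ν _ (≤-trans (m≤n+m X (length s)) (m≤n+m _ (d * s₁))) ⟩
    sum ν ∎
    where
    open ≡-Reasoning
    s₁ = at s 1
    X = d * length ν + sum ν
    s₁≤n : s₁ ≤ length ν
    s₁≤n = subst (_≤ length ν) (sym (match 0)) (diag≤length ν (suc (d * s₁) + 0))

  -- The entries of `s` and the diagonal counts obey the same balance equation and both vanish `J`
  -- places further on; telescoping back from there makes them agree.
  matching-unique : ∀ s ν {n} (r : InS s) (q : qexp m s ≡ n) → length ν ≡ n →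
    (∀ L → levelsOf n s L ≡ levels ν L) → Matches s ν
  matching-unique s ν r q refl same j = +-cancelʳ-≡ (∑ J (X j)) _ _ (begin
    at s (suc j) + ∑ J (X j)
      ≡⟨ descend (λ j → at s (suc j)) σ-step ⟩
    at s (suc (j + J)) + ∑ J (Y j)
      ≡⟨ cong (_+ ∑ J (Y j)) (trans (at-beyond s (j + J) (≤-trans (m≤m+n (length s) _) (m≤n+m J j))) (sym diag-zero)) ⟩
    diag ν (suc (d * at s 1) + (j + J)) + ∑ J (Y j)
      ≡⟨ descend (λ j → diag ν (o + j)) diag-step′ ⟨
    diag ν (o + j) + ∑ J (X j) ∎)
    where
    open ≡-Reasoning
    open Admissible s r q using (o; σ-balance)
    J = length s + (d * length ν + sum ν)
    X Y : ℕ → ℕ → ℕ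
    X j i = multiples (length ν) (o + (j + i))
    Y j i = levels ν (o + (j + i))
    descend : (f : ℕ → ℕ) → (∀ j → f j + multiples (length ν) (o + j) ≡ f (suc j) + levels ν (o + j)) →
      f j + ∑ J (X j) ≡ f (j + J) + ∑ J (Y j)
    descend f st = trans (cong (λ x → f x + ∑ J (X j)) (sym (+-identityʳ j)))
      (telescope J (λ i → f (j + i)) (X j) (Y j)
        (λ i _ → trans (st (j + i)) (cong (λ x → f x + Y j i) (sym (+-suc j i)))))
    σ-step : ∀ j → at s (suc j) + multiples (length ν) (o + j) ≡ at s (2 + j) + levels ν (o + j)
    σ-step j = trans (σ-balance j) (cong (at s (2 + j) +_) (same (o + j)))
    diag-step′ : ∀ j → diag ν (o + j) + multiples (length ν) (o + j) ≡ diag ν (o + suc j) + levels ν (o + j)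
    diag-step′ j = trans (diag-step ν (o + j)) (cong (λ x → diag ν x + levels ν (o + j)) (sym (+-suc o j)))
    diag-zero : diag ν (o + (j + J)) ≡ 0
    diag-zero = diag-high ν _ (s≤s (≤-trans (m≤n+m _ (length s)) (≤-trans (m≤n+m J j) (m≤n+m _ (d * at s 1)))))

  shrink* : ∀ s → InS s → ∀ k → at s (suc (d * k)) ≤ at s 1
  shrink* s r zero = ≤-reflexive (cong (at s ∘ suc) (*-zeroʳ d))
  shrink* s r (suc k) = ≤-trans
    (≤-reflexive (cong (at s ∘ suc) (trans (*-suc d k) (+-comm d (d * k)))))
    (≤-trans (shrink r (d * k)) (shrink* s r k))

  -- If `at s′ 1` exceeded `at s 1` by `k`, the diagonal that gives `at s′ 1` would also give the
  -- entry of `s` at `suc (d * k)`, which `shrink` bounds by `at s 1`.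
  matching-s₁ : ∀ s s′ ν → InS s → Matches s ν → Matches s′ ν → at s′ 1 ≤ at s 1
  matching-s₁ s s′ ν r match match′ with at s′ 1 ≤? at s 1
  ... | yes l = l
  ... | no l = subst (_≤ s₁) s′₁≡ (shrink* s r k)
    where
    s₁ = at s 1
    s′₁ = at s′ 1
    k = s′₁ ∸ s₁
    s′₁≡ : at s (suc (d * k)) ≡ s′₁
    s′₁≡ = begin
      at s (suc (d * k))                   ≡⟨ match (d * k) ⟩
      diag ν (suc (d * s₁ + d * k))        ≡⟨ cong (diag ν ∘ suc) (trans (sym (*-distribˡ-+ d s₁ k)) (cong (d *_) (m+[n∸m]≡n (<⇒≤ (≰⇒> l))))) ⟩
      diag ν (suc (d * s′₁))               ≡⟨ cong (diag ν ∘ suc) (+-identityʳ (d * s′₁)) ⟨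
      diag ν (suc (d * s′₁) + 0)           ≡⟨ match′ 0 ⟨
      s′₁                                  ∎
      where open ≡-Reasoning

  matching-injective : ∀ s s′ ν → InS s → InS s′ → Matches s ν → Matches s′ ν → length s ≡ length s′ → s ≡ s′
  matching-injective s s′ ν r r′ match match′ l = at-ext s s′ l λ j →
    trans (match j) (trans (cong (λ x → diag ν (suc (d * x) + j)) same) (sym (match′ j)))
    where
    same : at s 1 ≡ at s′ 1
    same = ≤-antisym (matching-s₁ s′ s ν r′ match′ match) (matching-s₁ s s′ ν r match match′)

  -- The sequence is read off the diagonals after those that `durfee` singles out. No cell lies
  -- beyond the diagonal `d * length ν + sum ν`, so `N` entries record everything.
  matching-exists : ∀ N ν → Chain 0 ν → d * length ν + sum ν ≤ N →
    ∃[ s ] (length s ≡ N × InS s × Matches s ν × (∀ L → L ≤ d * at s 1 → levels ν L ≡ 0))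
  matching-exists N ν ch N-large with durfee ν ch
  ... | s₁ , full , shrinking , low = s , length-applyUpTo f N ,
      record { step = st ; shrink = sh } ,
      (λ j → trans (at≡ j) (cong (λ x → diag ν (suc (d * x) + j)) (sym first≡))) ,
      (λ L l → low L (subst (λ x → L ≤ d * x) first≡ l))
    where
    n = length ν
    f : ℕ → ℕ
    f j = diag ν (suc (d * s₁) + j)
    s = applyUpTo f N
    at≡ : ∀ j → at s (suc j) ≡ f j
    at≡ j with suc j ≤? N
    ... | yes j<N = at-applyUpTo f N j j<N
    ... | no j≮N = trans (at-beyond s j (subst (_≤ j) (sym (length-applyUpTo f N)) (s≤s⁻¹ (≰⇒> j≮N))))
          (sym (diag-high ν _ (s≤s (≤-trans N-large (≤-trans (s≤s⁻¹ (≰⇒> j≮N)) (m≤n+m j (d * s₁)))))))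
    first≡ : at s 1 ≡ s₁
    first≡ = trans (at≡ 0) (trans (cong (diag ν) (+-identityʳ (suc (d * s₁)))) full)
    multiples≤χ : ∀ j → multiples n (suc (d * s₁) + j) ≤ χ∣ d (suc j)
    multiples≤χ j with d * s₁ + suc j ≤? d * n
    ... | yes l = ≤-reflexive (multiples-χ n s₁ j l)
    ... | no l = subst (_≤ χ∣ d (suc j)) (sym (multiples-high n _ (subst (d * n <_) (+-suc (d * s₁) j) (≰⇒> l)))) z≤n
    st : ∀ j → at s (2 + j) ≤ at s (suc j) + χ∣ d (suc j)
    st j = begin
      at s (2 + j)                                                  ≡⟨ at≡ (suc j) ⟩
      diag ν (suc (d * s₁) + suc j)                                 ≡⟨ cong (diag ν) (+-suc (suc (d * s₁)) j) ⟩
      diag ν (suc (suc (d * s₁) + j))                               ≤⟨ m≤m+n _ _ ⟩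
      diag ν (suc (suc (d * s₁) + j)) + levels ν (suc (d * s₁) + j) ≡⟨ diag-step ν (suc (d * s₁) + j) ⟨
      f j + multiples n (suc (d * s₁) + j)                          ≤⟨ +-monoʳ-≤ (f j) (multiples≤χ j) ⟩
      f j + χ∣ d (suc j)                                            ≡⟨ cong (_+ χ∣ d (suc j)) (at≡ j) ⟨
      at s (suc j) + χ∣ d (suc j)                                   ∎
      where open ≤-Reasoning
    sh : ∀ j → at s (suc (j + d)) ≤ at s (suc j)
    sh j = subst₂ _≤_ (trans (cong (diag ν ∘ suc) (+-assoc (d * s₁) j d)) (sym (at≡ (j + d)))) (sym (at≡ j))
      (shrinking (d * s₁ + j) (m≤m+n (d * s₁) j))

  levelsOf-matching : ∀ s ν → Matches s ν → (∀ L → L ≤ d * at s 1 → levels ν L ≡ 0) →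
    ∀ L → levelsOf (length ν) s L ≡ levels ν L
  levelsOf-matching s ν match low L with L ≤? d * at s 1
  ... | yes l = trans (levelsOf-low (length ν) s L l) (sym (low L l))
  ... | no l = subst (λ L → levelsOf n s L ≡ levels ν L) (m+[n∸m]≡n (≰⇒> l)) (begin
      levelsOf n s (o + j)                                           ≡⟨ levelsOf-high n s j ⟩
      (at s (suc j) + multiples n (o + j)) ∸ at s (2 + j)            ≡⟨ cong₂ (λ x y → (x + multiples n (o + j)) ∸ y) (match j) (trans (match (suc j)) (cong (diag ν) (+-suc o j))) ⟩
      (diag ν (o + j) + multiples n (o + j)) ∸ diag ν (suc (o + j))  ≡⟨ cong (_∸ diag ν (suc (o + j))) (diag-step ν (o + j)) ⟩
      (diag ν (suc (o + j)) + levels ν (o + j)) ∸ diag ν (suc (o + j)) ≡⟨ m+n∸m≡n (diag ν (suc (o + j))) _ ⟩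
      levels ν (o + j)                                               ∎)
    where
    open ≡-Reasoning
    n = length ν
    o = suc (d * at s 1)
    j = L ∸ o

  -- The incidence relation for the double counting: weighted by the statistic and summed over `ν`,
  -- it gives the contribution of `s` to the right-hand side; summed over `s`, it singles out the
  -- partitions of `n`.
  summand : ℕ → List ℕ → List ℕ → ℕ
  summand n ν s = ι (admissible n s) * hasLevels (levelsOf n s) ν

  summand-support : ∀ ν s → summand (length ν) ν s ≡ 0 ⊎ (InS s × Matches s ν × sum ν ≡ length ν)
  summand-support ν s with admissible (length ν) s in adm
  ... | false = inj₁ refl
  ... | true with ∧-true {inS m s} adm
  ...   | s∈S , q≡ᵇn with inS-sound s s∈S | ≡ᵇ⇒≡ _ _ (≡true⇒T q≡ᵇn)
  ...     | r | q with hasLevels-sound M b ν ∑b≡n b-bound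
    where open Admissible s r q
  ...       | inj₁ z = inj₁ (trans (+-identityʳ _) z)
  ...       | inj₂ (_ , same) = inj₂ (r , match , trans (sym (qexp-matching s ν match low)) q)
    where
    match : Matches s ν
    match = matching-unique s ν r q refl same
    low : ∀ L → L ≤ d * at s 1 → levels ν L ≡ 0
    low L l = trans (sym (same L)) (levelsOf-low (length ν) s L l)

  -- Existence and injectivity of the matching leave exactly one `s` when the size is right. In that
  -- case `suc d * length ν` is the bound `d * length ν + sum ν` on the diagonals; it is also the
  -- origin of the truncation bound in the theorem.
  ∑-summand : ∀ N ν → Chain 0 ν → suc d * length ν ≤ N →
    ∑ₗ N (length ν) (summand (length ν) ν) ≡ eq (sum ν) (length ν)
  ∑-summand N ν ch N-large with sum ν ≟ length ν
  ... | no ≢ = trans (∑ₗ-zero N (length ν) zero-off) (sym (eq-no ≢))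
    where
    zero-off : ∀ s → length s ≡ N → summand (length ν) ν s ≡ 0
    zero-off s _ with summand-support ν s
    ... | inj₁ z = z
    ... | inj₂ (_ , _ , ≡n) = ⊥-elim (≢ ≡n)
  ... | yes Σν≡n with matching-exists N ν ch (subst (_≤ N) (trans (+-comm (length ν) _) (cong (d * length ν +_) (sym Σν≡n))) N-large)
  ...   | s , refl , r , match , low = trans (∑ₗ-single (length ν) s bound zero-off) (trans here (sym (eq-yes Σν≡n)))
    where
    n = length ν
    bound : ∀ i → at s i ≤ n
    bound zero = subst (_≤ n) (sym (at-zero s)) z≤n
    bound (suc j) = subst (_≤ n) (sym (match j)) (diag≤length ν (suc (d * at s 1) + j))
    zero-off : ∀ s′ → length s′ ≡ length s → s′ ≢ s → summand n ν s′ ≡ 0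
    zero-off s′ l s′≢s with summand-support ν s′
    ... | inj₁ z = z
    ... | inj₂ (r′ , match′ , _) = ⊥-elim (s′≢s (matching-injective s′ s ν r′ r match′ match l))
    here : summand n ν s ≡ 1
    here = cong₂ _*_
      (cong ι (cong₂ _∧_ (inS-complete s r) (T⇒≡true (≡⇒≡ᵇ _ _ (trans (qexp-matching s ν match low) Σν≡n)))))
      (hasLevels-complete (levelsOf n s) ν (levelsOf-matching s ν match low))

-- From arms and legs of partitions to paths.

chainᵇ : ℕ → List ℕ → Bool
chainᵇ x [] = true
chainᵇ x (z ∷ ν) = (x ≤ᵇ z) ∧ chainᵇ z ν

∧-swap : ∀ a b c → a ∧ (b ∧ c) ≡ b ∧ (a ∧ c)
∧-swap a b c = trans (sym (∧-assoc a b c)) (trans (cong (_∧ c) (∧-comm a b)) (∧-assoc b a c))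

nonincr-snoc : ∀ μ y z → nonincr ((μ ++ [ y ]) ++ [ z ]) ≡ (z ≤ᵇ y) ∧ nonincr (μ ++ [ y ])
nonincr-snoc [] y z = refl
nonincr-snoc (x ∷ []) y z = ∧-swap (y ≤ᵇ x) (z ≤ᵇ y) true
nonincr-snoc (x ∷ x′ ∷ μ) y z = trans (cong ((x′ ≤ᵇ x) ∧_) (nonincr-snoc (x′ ∷ μ) y z)) (∧-swap (x′ ≤ᵇ x) (z ≤ᵇ y) _)

nonincr-reverse : ∀ ν → nonincr (reverse ν) ≡ chainᵇ 0 ν
nonincr-reverse [] = refl
nonincr-reverse (z ∷ []) = refl
nonincr-reverse (z ∷ y ∷ ν) =
  trans (cong nonincr (trans (unfold-reverse z (y ∷ ν)) (cong (_++ [ z ]) (unfold-reverse y ν))))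
  (trans (nonincr-snoc (reverse ν) y z)
    (cong ((z ≤ᵇ y) ∧_) (trans (cong nonincr (sym (unfold-reverse y ν))) (nonincr-reverse (y ∷ ν)))))

sum-map-reverse : ∀ (f : ℕ → ℕ) ν → sum (map f (reverse ν)) ≡ rowsum (λ _ y → f y) ν
sum-map-reverse f [] = refl
sum-map-reverse f (z ∷ ν) rewrite unfold-reverse z ν | sum-map-++ f (reverse ν) [ z ] | sum-map-reverse f ν =
  trans (+-comm _ (f z + 0)) (cong (_+ rowsum (λ _ y → f y) ν) (+-identityʳ (f z)))

sum-reverse : ∀ ν → sum (reverse ν) ≡ sum ν
sum-reverse ν = sum-↭ (↭-reverse ν)

at-++ˡ : ∀ μ z i → i < length μ → at (μ ++ [ z ]) (suc i) ≡ at μ (suc i)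
at-++ˡ (x ∷ μ) z zero _ = refl
at-++ˡ (x ∷ μ) z (suc i) (s≤s i<) = at-++ˡ μ z i i<

at-last : ∀ μ z → at (μ ++ [ z ]) (suc (length μ)) ≡ z
at-last [] z = refl
at-last (x ∷ μ) z = at-last μ z

∑-reverse : ∀ (f : ℕ → ℕ → ℕ) ν → ∑ (length ν) (λ i → f (suc i) (at (reverse ν) (suc i))) ≡ rowsum f ν
∑-reverse f [] = refl
∑-reverse f (z ∷ ν) rewrite unfold-reverse z ν = begin
  ∑ (suc n) (λ i → f (suc i) (at (μ ++ [ z ]) (suc i)))
    ≡⟨ ∑-snoc n (λ i → f (suc i) (at (μ ++ [ z ]) (suc i))) ⟩
  ∑ n (λ i → f (suc i) (at (μ ++ [ z ]) (suc i))) + f (suc n) (at (μ ++ [ z ]) (suc n))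
    ≡⟨ cong₂ _+_ (∑-cong n (λ i i<n → cong (f (suc i)) (at-++ˡ μ z i (subst (i <_) (sym (length-reverse ν)) i<n))))
                 (cong (f (suc n)) (trans (cong (at (μ ++ [ z ]) ∘ suc) (sym (length-reverse ν))) (at-last μ z))) ⟩
  ∑ n (λ i → f (suc i) (at μ (suc i))) + f (suc n) z
    ≡⟨ cong (_+ f (suc n) z) (∑-reverse f ν) ⟩
  rowsum f ν + f (suc n) z
    ≡⟨ +-comm (rowsum f ν) _ ⟩
  f (suc n) z + rowsum f ν ∎
  where
  open ≡-Reasoning
  n = length ν
  μ = reverse ν

rowsum-cong-chain : ∀ {z f g} ν → Chain z ν →
  (∀ i y → i ≤ length ν → z ≤ y → f i y ≡ g i y) → rowsum f ν ≡ rowsum g ν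
rowsum-cong-chain [] _ e = refl
rowsum-cong-chain (y ∷ ν) (z≤y , ch) e = cong₂ _+_ (e _ y ≤-refl z≤y)
  (rowsum-cong-chain ν ch (λ i y′ i≤ y≤y′ → e i y′ (m≤n⇒m≤1+n i≤) (≤-trans z≤y y≤y′)))

rowsum-∑ : ∀ n (f : ℕ → ℕ → ℕ → ℕ) ν → rowsum (λ i y → ∑ n (f i y)) ν ≡ ∑ n (λ w → rowsum (λ i y → f i y w) ν)
rowsum-∑ n f [] = sym (∑-zero n (λ _ _ → refl))
rowsum-∑ n f (z ∷ ν) rewrite rowsum-∑ n f ν = sym (∑-+ n (f (suc (length ν)) z) (λ w → rowsum (λ i y → f i y w) ν))

height : List ℕ → ℕ → ℕ
height ν c = rowsum (λ _ y → le c y) ν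

height-full : ∀ {z c} ν → Chain z ν → c ≤ z → height ν c ≡ length ν
height-full [] _ _ = refl
height-full (y ∷ ν) (z≤y , ch) c≤z = cong₂ _+_ (le-yes (≤-trans c≤z z≤y)) (height-full ν ch (≤-trans c≤z z≤y))

conj-reverse : ∀ ν c → conj (reverse ν) c ≡ height ν c
conj-reverse ν c = trans (count≡sum (c ≤ᵇ_) (reverse ν)) (sum-map-reverse (le c) ν)

eq-sym : ∀ x y → eq x y ≡ eq y x
eq-sym x y with x ≟ y
... | yes refl = refl
... | no x≢y = trans (eq-no x≢y) (sym (eq-no (x≢y ∘ sym)))

∑ₗ-∑↗-comm : ∀ N b r x c (F : List ℕ → List ℕ → ℕ) →
  ∑ₗ N b (λ s → ∑↗ r x c (F s)) ≡ ∑↗ r x c (λ ν → ∑ₗ N b (λ s → F s ν))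
∑ₗ-∑↗-comm N b zero x c F = refl
∑ₗ-∑↗-comm N b (suc r) x zero F = ∑ₗ-∑↗-comm N b r x zero (λ s → F s ∘ (x ∷_))
∑ₗ-∑↗-comm N b (suc r) x (suc c) F = trans
  (∑ₗ-+ N b (λ s → ∑↗ r x (suc c) (F s ∘ (x ∷_))) (λ s → ∑↗ (suc r) (suc x) c (F s)))
  (cong₂ _+_ (∑ₗ-∑↗-comm N b r x (suc c) (λ s → F s ∘ (x ∷_))) (∑ₗ-∑↗-comm N b (suc r) (suc x) c F))

-- One recursion chooses the first entry outright, the other reaches it by unit steps; `unroll`
-- passes between them under the common cap `b`.
∑ₗ-chain : ∀ r x c F → ∑ₗ r (x + c) (λ ν → ι (chainᵇ x ν) * F ν) ≡ ∑↗ r x c F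
∑ₗ-chain zero x c F = +-identityʳ (F [])
∑ₗ-chain (suc r) x c F = begin
  ∑ (suc (x + c)) (λ z → ∑ₗ r b (λ ν → ι ((x ≤ᵇ z) ∧ chainᵇ z ν) * F (z ∷ ν)))
    ≡⟨ cong (λ X → ∑ X G′) (+-suc x c) ⟨
  ∑ (x + suc c) G′
    ≡⟨ ∑-split x (suc c) G′ ⟩
  ∑ x G′ + ∑ (suc c) (λ j → G′ (x + j))
    ≡⟨ cong₂ _+_ (∑-zero x low) (∑-cong (suc c) (λ j _ → high j)) ⟩
  ∑ (suc c) (λ j → G (x + j))
    ≡⟨ unroll x c refl ⟩
  ∑↗ (suc r) x c F ∎
  where
  open ≡-Reasoning
  b = x + c
  G′ G : ℕ → ℕ
  G′ z = ∑ₗ r b (λ ν → ι ((x ≤ᵇ z) ∧ chainᵇ z ν) * F (z ∷ ν))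
  G z = ∑ₗ r b (λ ν → ι (chainᵇ z ν) * F (z ∷ ν))
  low : ∀ z → z < x → G′ z ≡ 0
  low z z<x = ∑ₗ-zero r b (λ ν _ → cong (_* F (z ∷ ν)) (trans (ι-∧ (x ≤ᵇ z) (chainᵇ z ν)) (cong (_* ι (chainᵇ z ν)) (le-no z<x))))
  high : ∀ j → G′ (x + j) ≡ G (x + j)
  high j = ∑ₗ-cong r b (λ ν _ → cong (_* F (x + j ∷ ν)) (trans (ι-∧ (x ≤ᵇ x + j) (chainᵇ (x + j) ν))
    (trans (cong (_* ι (chainᵇ (x + j) ν)) (le-yes (m≤m+n x j))) (+-identityʳ _))))
  G≡ : ∀ z c → z + c ≡ b → G z ≡ ∑↗ r z c (F ∘ (z ∷_))
  G≡ z c p = trans (cong (λ b → ∑ₗ r b (λ ν → ι (chainᵇ z ν) * F (z ∷ ν))) (sym p)) (∑ₗ-chain r z c (F ∘ (z ∷_)))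
  unroll : ∀ x c → x + c ≡ b → ∑ (suc c) (λ j → G (x + j)) ≡ ∑↗ (suc r) x c F
  unroll x zero p = trans (+-identityʳ _) (trans (cong G (+-identityʳ x)) (G≡ x 0 p))
  unroll x (suc c) p = cong₂ _+_ (trans (cong G (+-identityʳ x)) (G≡ x (suc c) p))
    (trans (∑-cong (suc c) (λ j _ → cong G (+-suc x j))) (unroll (suc x) c (trans (sym (+-suc x c)) p)))

module _ (e : ℕ) where

  open Sequences e
  open Matching e
  open Paths d

  -- The divisibility condition is automatic: if d l = a + 1 then a + l + 1 = (d + 1) l.
  hcond-eq : ∀ a l → ι (hcond d 1 a l) ≡ eq (d * l) (a + 1)
  hcond-eq a l with d * l ≟ 1 * (a + 1)
  ... | no ≢ = trans (ι-∧ (d * l ≡ᵇ 1 * (a + 1)) _)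
        (trans (cong (_* ι ⌊ (d + 1) ∣? (a + l + 1) ⌋) (eq-no ≢))
          (sym (eq-no (λ p → ≢ (trans p (sym (+-identityʳ (a + 1))))))))
  ... | yes p = trans (ι-∧ (d * l ≡ᵇ 1 * (a + 1)) _)
        (trans (cong₂ _*_ (eq-yes p) (cong ι (trans (isYes≗does ((d + 1) ∣? (a + l + 1))) (dec-true ((d + 1) ∣? (a + l + 1)) div))))
          (sym (eq-yes (trans p (+-identityʳ (a + 1))))))
    where
    open ≡-Reasoning
    shuffle : ∀ a l → a + l + 1 ≡ (a + 1) + l
    shuffle = solve-∀
    factorise : ∀ d l → d * l + l ≡ l * (d + 1)
    factorise = solve-∀
    div : (d + 1) ∣ (a + l + 1)
    div = divides l (begin
      a + l + 1        ≡⟨ shuffle a l ⟩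
      (a + 1) + l      ≡⟨ cong (_+ l) (trans (sym (+-identityʳ (a + 1))) (sym p)) ⟩
      d * l + l        ≡⟨ factorise d l ⟩
      l * (d + 1)      ∎)

  -- Adding d i + c to both sides of a + 1 = d l gives on the left the level of the N-step at the
  -- end of the row, on the right that of the E-step at the foot of the column.
  hcond-level : ∀ i y c κ → c < y → i ≤ κ → ι (hcond d 1 (y ∸ suc c) (κ ∸ i)) ≡ eq (d * i + y) (d * κ + c)
  hcond-level i y c κ c<y i≤κ = begin
    ι (hcond d 1 a l)                      ≡⟨ hcond-eq a l ⟩
    eq (d * l) (a + 1)                     ≡⟨ eq-sym (d * l) (a + 1) ⟩
    eq (a + 1) (d * l)                     ≡⟨ eq-shift (d * i + c) (a + 1) (d * l) ⟨
    eq (d * i + c + (a + 1)) (d * i + c + d * l)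
      ≡⟨ cong₂ eq (trans (left (d * i) c a) (cong (d * i +_) (m+[n∸m]≡n c<y)))
                  (trans (right d i c l) (cong (λ κ → d * κ + c) (m+[n∸m]≡n i≤κ))) ⟩
    eq (d * i + y) (d * κ + c)             ∎
    where
    open ≡-Reasoning
    a = y ∸ suc c
    l = κ ∸ i
    left : ∀ p c a → p + c + (a + 1) ≡ p + (suc c + a)
    left = solve-∀
    right : ∀ d i c l → d * i + c + d * l ≡ d * (i + l) + c
    right = solve-∀

  hookRows : ℕ → List ℕ → ℕ
  hookRows x ν = rowsum (λ i y → ∑ (y ∸ x) (λ w → ι (hcond d 1 (y ∸ suc (x + w)) (height ν (suc (x + w)) ∸ i)))) ν

  -- The columns after `x` up to the bottom row's length `z` have full height, so there the count by
  -- rows turns into one by columns by exchanging sums. The columns after `z` do not meet the bottom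
  -- row and are left to the induction.
  hookRows≡hook : ∀ x ν → Chain x ν → hookRows x ν ≡ hook x ν
  hookRows≡hook x [] _ = refl
  hookRows≡hook x (z ∷ ν) (x≤z , ch) = begin
    ∑ D (f (suc n) z) + rowsum (λ i y → ∑ (y ∸ x) (f i y)) ν
      ≡⟨ cong₂ _+_ (∑-cong D (λ w w<D → first (suc n) z w ≤-refl ≤-refl w<D)) (rowsum-cong-chain ν ch split) ⟩
    ∑ D (g (suc n) z) + rowsum (λ i y → ∑ D (g i y) + ∑ (y ∸ z) (f′ i y)) ν
      ≡⟨ cong (∑ D (g (suc n) z) +_) (rowsum-+ (λ i y → ∑ D (g i y)) (λ i y → ∑ (y ∸ z) (f′ i y)) ν) ⟩
    ∑ D (g (suc n) z) + (rowsum (λ i y → ∑ D (g i y)) ν + hookRows z ν)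
      ≡⟨ +-assoc (∑ D (g (suc n) z)) _ _ ⟨
    rowsum (λ i y → ∑ D (g i y)) (z ∷ ν) + hookRows z ν
      ≡⟨ cong₂ _+_ (rowsum-∑ D g (z ∷ ν)) (hookRows≡hook z ν ch) ⟩
    ∑ D (λ w → levels (z ∷ ν) (d * suc n + (x + w))) + hook z ν ∎
    where
    open ≡-Reasoning
    n = length ν
    D = z ∸ x
    f f′ g : ℕ → ℕ → ℕ → ℕ
    f i y w = ι (hcond d 1 (y ∸ suc (x + w)) (height (z ∷ ν) (suc (x + w)) ∸ i))
    f′ i y w = ι (hcond d 1 (y ∸ suc (z + w)) (height ν (suc (z + w)) ∸ i))
    g i y w = eq (d * i + y) (d * suc n + (x + w))
    first : ∀ i y w → i ≤ suc n → z ≤ y → w < D → f i y w ≡ g i y w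
    first i y w i≤ z≤y w<D = trans
      (cong (λ κ → ι (hcond d 1 (y ∸ suc (x + w)) (κ ∸ i))) (height-full {z} (z ∷ ν) (≤-refl , ch) x+w<z))
      (hcond-level i y (x + w) (suc n) (≤-trans x+w<z z≤y) i≤)
      where
      x+w<z : x + w < z
      x+w<z = subst (x + w <_) (m+[n∸m]≡n x≤z) (+-monoʳ-< x w<D)
    split : ∀ i y → i ≤ n → z ≤ y → ∑ (y ∸ x) (f i y) ≡ ∑ D (g i y) + ∑ (y ∸ z) (f′ i y)
    split i y i≤n z≤y = begin
      ∑ (y ∸ x) (f i y)                                        ≡⟨ cong (λ X → ∑ X (f i y)) y∸x ⟩
      ∑ (D + (y ∸ z)) (f i y)                                  ≡⟨ ∑-split D (y ∸ z) (f i y) ⟩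
      ∑ D (f i y) + ∑ (y ∸ z) (λ w → f i y (D + w))            ≡⟨ cong₂ _+_ (∑-cong D (λ w w<D → first i y w (m≤n⇒m≤1+n i≤n) z≤y w<D)) (∑-cong (y ∸ z) (λ w _ → shifted w)) ⟩
      ∑ D (g i y) + ∑ (y ∸ z) (f′ i y)                         ∎
      where
      y∸x : y ∸ x ≡ D + (y ∸ z)
      y∸x = sym (trans (sym (+-∸-assoc D z≤y)) (trans (cong (_∸ z) (trans (+-comm D y) (sym (+-∸-assoc y x≤z))))
        (trans (∸-+-assoc (y + z) x z) (trans (cong ((y + z) ∸_) (+-comm x z)) (trans (sym (∸-+-assoc (y + z) z x)) (cong (_∸ x) (m+n∸n≡m y z)))))))
      shifted : ∀ w → f i y (D + w) ≡ f′ i y w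
      shifted w = cong₂ (λ c κ → ι (hcond d 1 (y ∸ suc c) (κ ∸ i))) index
        (trans (cong (height (z ∷ ν) ∘ suc) index) (cong (_+ height ν (suc (z + w))) (le-no (s≤s (m≤m+n z w)))))
        where
        index : x + (D + w) ≡ z + w
        index = trans (sym (+-assoc x D w)) (cong (_+ w) (m+[n∸m]≡n x≤z))

  h-reverse : ∀ ν → Chain 0 ν → h d 1 (reverse ν) ≡ hook 0 ν
  h-reverse ν ch = begin
    h d 1 μ
      ≡⟨ count≡sum _ (cells μ) ⟩
    _
      ≡⟨ sum-map-concatMap _ (λ r → map (λ c → (r , c)) (range1 (at μ r))) (range1 (length μ)) ⟩
    sum (map (λ r → sum (map _ (map (λ c → (r , c)) (range1 (at μ r))))) (range1 (length μ)))
      ≡⟨ sum-map-cong (λ r → trans (sum-map-map _ (λ c → (r , c)) (range1 (at μ r))) (sum-range1 (λ c → ι (hcond d 1 (arm μ r c) (leg μ r c))) (at μ r))) (range1 (length μ)) ⟩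
    sum (map row (range1 (length μ)))
      ≡⟨ sum-range1 row (length μ) ⟩
    ∑ (length μ) (row ∘ suc)
      ≡⟨ cong (λ X → ∑ X (row ∘ suc)) (length-reverse ν) ⟩
    ∑ (length ν) (row ∘ suc)
      ≡⟨ ∑-cong (length ν) (λ i _ → ∑-cong (at μ (suc i)) (λ c _ →
           cong (λ κ → ι (hcond d 1 (at μ (suc i) ∸ suc c) (κ ∸ suc i))) (conj-reverse ν (suc c)))) ⟩
    ∑ (length ν) (λ i → ∑ (at μ (suc i)) (λ c → ι (hcond d 1 (at μ (suc i) ∸ suc c) (height ν (suc c) ∸ suc i))))
      ≡⟨ ∑-reverse (λ i y → ∑ y (λ c → ι (hcond d 1 (y ∸ suc c) (height ν (suc c) ∸ i)))) ν ⟩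
    hookRows 0 ν
      ≡⟨ hookRows≡hook 0 ν ch ⟩
    hook 0 ν ∎
    where
    open ≡-Reasoning
    μ = reverse ν
    row : ℕ → ℕ
    row r = ∑ (at μ r) (λ c → ι (hcond d 1 (arm μ r (suc c)) (leg μ r (suc c))))

  chainᵇ-sound : ∀ x ν → chainᵇ x ν ≡ true → Chain x ν
  chainᵇ-sound x [] _ = _
  chainᵇ-sound x (z ∷ ν) p = ≤ᵇ⇒≤ x z (≡true⇒T (proj₁ (∧-true p))) , chainᵇ-sound z ν (proj₂ (∧-true {x ≤ᵇ z} p))

  -- The cap `c` is left open so that it can be set to the one at which the right-hand side is
  -- expanded.
  lhs-paths : ∀ n k c → n ≤ c → lhsCoeff m n k ≡ ∑↗ n 0 c (λ ν → eq (sum ν) n * eq (hook 0 ν) k)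
  lhs-paths n k c n≤c = begin
    lhsCoeff m n k
      ≡⟨ count-filter (λ μ → h d 1 μ ≡ᵇ k) (isPartitionOf n) (lists n n) ⟩
    sum (map P (lists n n))
      ≡⟨ sum-lists n n P ⟩
    ∑ₗ n n P
      ≡⟨ ∑ₗ-sum-bound n n n (c ∸ n) P ≤-refl off ⟨
    ∑ₗ n (n + (c ∸ n)) P
      ≡⟨ cong (λ b → ∑ₗ n b P) (m+[n∸m]≡n n≤c) ⟩
    ∑ₗ n c P
      ≡⟨ ∑ₗ-reverse n c P ⟩
    ∑ₗ n c (P ∘ reverse)
      ≡⟨ ∑ₗ-cong n c (λ ν _ → convert ν) ⟩
    ∑ₗ n c (λ ν → ι (chainᵇ 0 ν) * (eq (sum ν) n * eq (hook 0 ν) k))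
      ≡⟨ ∑ₗ-chain n 0 c (λ ν → eq (sum ν) n * eq (hook 0 ν) k) ⟩
    ∑↗ n 0 c (λ ν → eq (sum ν) n * eq (hook 0 ν) k) ∎
    where
    open ≡-Reasoning
    P : List ℕ → ℕ
    P μ = ι (isPartitionOf n μ) * eq (h d 1 μ) k
    off : ∀ μ → sum μ ≢ n → P μ ≡ 0
    off μ ≢ = cong (_* eq (h d 1 μ) k) (trans (ι-∧ (nonincr μ) (sum μ ≡ᵇ n))
      (trans (cong (ι (nonincr μ) *_) (eq-no ≢)) (*-zeroʳ (ι (nonincr μ)))))
    convert : ∀ ν → P (reverse ν) ≡ ι (chainᵇ 0 ν) * (eq (sum ν) n * eq (hook 0 ν) k)
    convert ν rewrite ι-∧ (nonincr (reverse ν)) (sum (reverse ν) ≡ᵇ n) | nonincr-reverse ν | sum-reverse ν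
      with chainᵇ 0 ν in ch
    ... | false = refl
    ... | true = trans (cong (λ t → (eq (sum ν) n + 0) * eq t k) (h-reverse ν (chainᵇ-sound 0 ν ch)))
        (trans (cong (_* eq (hook 0 ν) k) (+-identityʳ (eq (sum ν) n))) (sym (+-identityʳ _)))

  rhs-paths : ∀ N n k → suc d * n ≤ N →
    rhsCoeffTrunc m N n k ≡ ∑↗ n 0 (suc (d * n + N)) (λ ν → eq (sum ν) n * eq (hook 0 ν) k)
  rhs-paths N n k N-large = begin
    rhsCoeffTrunc m N n k
      ≡⟨ sum-lists N n R ⟩
    ∑ₗ N n R
      ≡⟨ ∑ₗ-cong N n expand ⟩
    ∑ₗ N n (λ s → ∑↗ n 0 M (λ ν → summand n ν s * eq (hook 0 ν) k))
      ≡⟨ ∑ₗ-∑↗-comm N n n 0 M (λ s ν → summand n ν s * eq (hook 0 ν) k) ⟩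
    ∑↗ n 0 M (λ ν → ∑ₗ N n (λ s → summand n ν s * eq (hook 0 ν) k))
      ≡⟨ ∑↗-cong n 0 M collect ⟩
    ∑↗ n 0 M (λ ν → eq (sum ν) n * eq (hook 0 ν) k) ∎
    where
    open ≡-Reasoning
    M = suc (d * n + N)
    R : List ℕ → ℕ
    R s = if admissible n s then coeff k (prodFactors m s) else 0
    expand : ∀ s → length s ≡ N → R s ≡ ∑↗ n 0 M (λ ν → summand n ν s * eq (hook 0 ν) k)
    expand s refl with admissible n s in adm
    ... | false = sym (∑↗-0 n 0 M)
    ... | true with ∧-true {inS m s} adm
    ...   | s∈S , q = trans (Admissible.coeff-prodFactors s (inS-sound s s∈S) (≡ᵇ⇒≡ _ _ (≡true⇒T q)) k)
            (∑↗-cong n 0 M (λ ν _ _ → cong (_* eq (hook 0 ν) k) (sym (+-identityʳ (hasLevels (levelsOf n s) ν)))))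
    collect : ∀ ν → length ν ≡ n → Chain 0 ν →
      ∑ₗ N n (λ s → summand n ν s * eq (hook 0 ν) k) ≡ eq (sum ν) n * eq (hook 0 ν) k
    collect ν refl ch = trans (∑ₗ-*ʳ N n (summand n ν) (eq (hook 0 ν) k))
      (cong (_* eq (hook 0 ν) k) (∑-summand N ν ch N-large))

theorem3p1 : (m : ℕ) → 2 ≤ m → (n k : ℕ) →
    ∃[ N₀ ] ((N : ℕ) → N₀ ≤ N → rhsCoeffTrunc m N n k ≡ lhsCoeff m n k)
theorem3p1 (suc zero) (s≤s ())
theorem3p1 (suc (suc e)) _ n k = suc d * n , λ N N-large →
  trans (rhs-paths e N n k N-large) (sym (lhs-paths e n k _ (m≤n⇒m≤1+n (≤-trans (m≤n*m n d) (m≤m+n (d * n) N)))))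
  where
  d = suc e
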